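{- Let $\epsilon\in(0,1)$, and consider instances of Fair Max-Min diversification with $m=2$ groups, $n$ points, parameters $k_1,k_2$, $k=k_1+k_2$, optimal diversity $\ell^*$, whose points arrive one by one in a stream, where a lower bound on the minimum and an upper bound on the maximum pairwise distance are given with ratio $\mathrm{poly}(n)$. There is a one-pass streaming algorithm that returns a $4(1+\epsilon)$-approximation for the Fair Max-Min diversification problem, i.e. a set $\mathcal{S}\subseteq\mathcal{X}$ with $|\mathcal{S}\cap\mathcal{X}_i|=k_i$ for $i\in\{1,2\}$ and $\mathrm{div}(\mathcal{S})\ge\ell^*/(4(1+\epsilon))$, using $O(k\epsilon^{ -1}\log n)$ space.
   Context: Fair Max-Min diversification: the input is a finite metric space $(\mathcal{X},d)$ with $|\mathcal{X}|=n$, where $\mathcal{X}=\bigcup_{i=1}^m\mathcal{X}_i$ is partitioned into $m$ disjoint groups, and non-negative integers $k_1,\dots,k_m$ with $k_i\le|\mathcal{X}_i|$. For $\mathcal{S}\subseteq\mathcal{X}$ let $\mathrm{div}(\mathcal{S})=\min_{u,v\in\mathcal{S},u\ne v}d(u,v)$ (the minimum over the empty set is $+\infty$). The optimal diversity is $\ell^*=\max\{\mathrm{div}(\mathcal{S}):\mathcal{S}\subseteq\mathcal{X},\ |\mathcal{S}\cap\mathcal{X}_i|=k_i\ \forall i\in[m]\}$. Streaming: points are revealed one at a time (with their group), in one pass; space is measured in the number of stored points, and distances between stored points (and the current point) can be evaluated. -}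

module Defs where

open import Algebra.Bundles using (CommutativeRing)
import Algebra.Definitions.RawMonoid as Multiples
open import Data.Fin.Base using (Fin)
open import Data.Fin.Properties using (_≟_)
open import Data.Fin.Subset using (Subset; _∩_; ∣_∣; ⋃; ⁅_⁆)
open import Data.Fin.Subset.Properties using (_∈?_)
open import Data.List.Base as List
  using (List; []; length; map; filter; foldl; inits; allFin; cartesianProduct)
import Data.List.Extrema
open import Data.List.Extrema.Nat using () renaming (max to maxℕ)
open import Data.Nat.Base as ℕ using (ℕ)
open import Data.Product.Base using (∃-syntax; _×_; _,_; proj₁; proj₂)
open import Data.Vec.Base using (tabulate)
open import Data.Vec.Functional as Vector using (Vector)
open import Function.Base using (_∘_)
open import Function.Metric.Structures using (IsGeneralMetric)
open import Level using (Level; _⊔_)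
open import Relation.Binary.Bundles using (TotalOrder)
open import Relation.Binary.Core using (Rel)
open import Relation.Binary.Structures using (IsDecTotalOrder)
import Relation.Binary.Construct.Add.Supremum.Equality as SupremumEquality
import Relation.Binary.Construct.Add.Supremum.NonStrict as SupremumOrder
import Relation.Binary.Construct.NonStrictToStrict as ToStrict
open import Relation.Binary.PropositionalEquality.Core using (_≡_)
open import Relation.Nullary.Construct.Add.Supremum using (_⁺; ⊤⁺; [_])
open import Relation.Nullary.Decidable using (⌊_⌋; ¬?; _×-dec_)
open import Relation.Nullary.Negation using (¬_)

-- The values of the metric. Classically these fields are exactly the subfields
-- of ℝ, including ℝ itself. The order is decidable because algorithms branch on
-- comparisons of distances. The value 0# ⁻¹ is unconstrained.

record ArchimedeanOrderedField (c ℓ₁ ℓ₂ : Level) : Set (Level.suc (c ⊔ ℓ₁ ⊔ ℓ₂)) where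
  infix 4 _≤_ _<_
  infix 8 _⁻¹
  infixl 7 _/_

  field
    commutativeRing : CommutativeRing c ℓ₁

  open CommutativeRing commutativeRing public

  field
    _≤_             : Rel Carrier ℓ₂
    isDecTotalOrder : IsDecTotalOrder _≈_ _≤_
    _⁻¹             : Carrier → Carrier

  open Multiples +-rawMonoid using () renaming (_×_ to _·_)

  fromℕ : ℕ → Carrier
  fromℕ n = n · 1#

  field
    0≉1         : ¬ (0# ≈ 1#)
    ⁻¹-inverseʳ : ∀ {x} → ¬ (x ≈ 0#) → x * x ⁻¹ ≈ 1#
    +-monoˡ-≤   : ∀ z {x y} → x ≤ y → x + z ≤ y + z
    *-nonNeg    : ∀ {x y} → 0# ≤ x → 0# ≤ y → 0# ≤ x * y
    archimedean : ∀ x → ∃[ n ] (x ≤ fromℕ n)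

  _<_ : Rel Carrier (ℓ₁ ⊔ ℓ₂)
  _<_ = ToStrict._<_ _≈_ _≤_

  _/_ : Carrier → Carrier → Carrier
  x / y = x * y ⁻¹

module Diversification {c ℓ₁ ℓ₂} (F : ArchimedeanOrderedField c ℓ₁ ℓ₂) where

  open ArchimedeanOrderedField F

  -- Diversities live in Carrier ⁺, that is, the field with +∞ adjoined as ⊤⁺.

  open SupremumOrder _≤_ public using (_≤⁺_)
  open SupremumEquality _≈_ public using (_≈⁺_)

  ≤⁺-totalOrder : TotalOrder _ _ _
  ≤⁺-totalOrder = record
    { isTotalOrder = SupremumOrder.≤⁺-isTotalOrder _≤_
        (IsDecTotalOrder.isTotalOrder isDecTotalOrder) }

  open Data.List.Extrema ≤⁺-totalOrder using (min)

  infixl 7 _/⁺_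

  _/⁺_ : Carrier ⁺ → Carrier → Carrier ⁺
  [ x ] /⁺ y = [ x / y ]
  ⊤⁺    /⁺ y = ⊤⁺

  record Instance (m : ℕ) : Set (c ⊔ ℓ₁ ⊔ ℓ₂) where
    field
      n        : ℕ
      d        : Fin n → Fin n → Carrier
      isMetric : IsGeneralMetric _≡_ _≈_ _≤_ 0# _+_ d
      group    : Fin n → Fin m
      k        : Fin m → ℕ

    𝒳 : Fin m → Subset n
    𝒳 i = tabulate (λ x → ⌊ group x ≟ i ⌋)

    field
      k≤∣𝒳∣ : ∀ i → k i ℕ.≤ ∣ 𝒳 i ∣

    totalSize : ℕ
    totalSize = List.sum (List.tabulate k)

    div : Subset n → Carrier ⁺
    div S = min ⊤⁺ (map (λ (u , v) → [ d u v ])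
      (filter (λ (u , v) → (u ∈? S) ×-dec (v ∈? S) ×-dec ¬? (u ≟ v))
        (cartesianProduct (allFin n) (allFin n))))

    Feasible : Subset n → Set
    Feasible S = ∀ i → ∣ S ∩ 𝒳 i ∣ ≡ k i

    IsOptimalDiversity : Carrier ⁺ → Set (c ⊔ ℓ₁ ⊔ ℓ₂)
    IsOptimalDiversity ℓ* =
      (∃[ S ] (Feasible S × div S ≈⁺ ℓ*)) × (∀ S → Feasible S → div S ≤⁺ ℓ*)

  -- The memory is a list of cells, each holding a stored point and a tag from an
  -- alphabet fixed in advance; there is no other state. The algorithm never sees
  -- the points themselves: it addresses them by position and is given only the
  -- tags of the cells and the pairwise distances and groups of the points.
  --
  -- In `step`, position zero is the arriving point and position suc i is the
  -- i-th cell. The result lists the cells of the new memory, so points can be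
  -- kept, dropped or retagged, but a point that was dropped cannot be recovered.

  record StreamingAlgorithm (m : ℕ) : Set c where
    field
      tags   : ℕ
      step   : ∀ {s} → Vector (Fin tags) s →
               (Fin (ℕ.suc s) → Fin (ℕ.suc s) → Carrier) → Vector (Fin m) (ℕ.suc s) →
               List (Fin tags × Fin (ℕ.suc s))
      output : ∀ {s} → Vector (Fin tags) s →
               (Fin s → Fin s → Carrier) → Vector (Fin m) s →
               List (Fin s)

  module Run {m : ℕ} (alg : StreamingAlgorithm m) (I : Instance m) where

    open StreamingAlgorithm alg
    open Instance I

    Memory : Set
    Memory = List (Fin tags × Fin n)

    cellTags : (M : Memory) → Vector (Fin tags) (length M)
    cellTags M = proj₁ ∘ List.lookup M

    cellPoints : (M : Memory) → Vector (Fin n) (length M)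
    cellPoints M = proj₂ ∘ List.lookup M

    receive : Memory → Fin n → Memory
    receive M x =
      map (λ (t , i) → t , p i) (step (cellTags M) (λ i j → d (p i) (p j)) (group ∘ p))
      where
      p : Vector (Fin n) (ℕ.suc (length M))
      p = x Vector.∷ cellPoints M

    memoryAfter : List (Fin n) → Memory
    memoryAfter = foldl receive []

    result : List (Fin n) → Subset n
    result stream =
      ⋃ (map (⁅_⁆ ∘ p) (output (cellTags M) (λ i j → d (p i) (p j)) (group ∘ p)))
      where
      M : Memory
      M = memoryAfter stream

      p : Vector (Fin n) (length M)
      p = cellPoints M

    -- The maximal number of cells in use, over all moments of the pass. Two cells
    -- holding the same point are counted twice.

    space : List (Fin n) → ℕ
    space stream = maxℕ 0 (map (length ∘ memoryAfter) (inits stream))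

{-# OPTIONS --safe #-}

-- Guess the optimum ℓ* along the radii r = lo/4, (1+ε)lo/4, (1+ε)²lo/4, … and keep,
-- for every guess, three greedy sets of points at mutual distance at least 2r: one
-- of at most k₁+k₂ points of any colour and one of at most kᵢ points of each colour.
-- An open ball of radius 2r contains at most one point of a set separated by 4r, so
-- if 4r ≤ ℓ* then the optimal solution forces all three greedy sets to be full. By
-- the same argument with half the radii, a full level yields a fair set at mutual
-- distance at least r: fill up the colour that is underrepresented in the colour-blind
-- set with points of its monochromatic set that are r away from those already present,
-- and drop the points of the other colour that came too close. If r is the largest
-- full guess, then ℓ* ≤ 4(1+ε)r.
--
-- Running the greedy algorithms only on the retained points, those that some greedy
-- set accepted on arrival, reproduces the greedy sets of the whole stream.

module Submission where

open import Algebra.Bundles using (Semiring)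
import Algebra.Properties.Semiring.Mult as Mult
open import Data.Bool.Base using (if_then_else_; true; false; T)
open import Data.Bool.Properties using (T-≡)
open import Data.Fin.Base using (Fin; zero; suc)
open import Data.Fin.Patterns using (0F; 1F)
open import Data.Fin.Properties using (_≟_)
open import Data.Fin.Subset
  using (Subset; ∣_∣; ⋃; ⁅_⁆; inside; outside; _∩_; ⊤)
  renaming (_∈_ to _∈ˢ_)
open import Data.Fin.Subset.Properties
  using (_∈?_; x∈⁅x⁆; x∈⁅y⁆⇒x≡y; x∈p∪q⁻; x∈p∪q⁺; x∈p∩q⁺; x∈p∩q⁻; ∉⊥; drop-there; ∩-identityˡ)
open import Data.List.Base as List
  using (List; []; _∷_; _++_; length; map; filter; foldr; take; tabulate; allFin;
        cartesianProduct; foldl; reverse; inits)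
import Data.List.Extrema
open import Data.List.Extrema.Nat using () renaming (max to maxℕ; max≤v⁺ to maxℕ≤v⁺)
open import Data.List.Membership.Propositional using (_∈_)
open import Data.List.Membership.Propositional.Properties
  using (∈-filter⁻; ∈-++⁺ˡ; ∈-++⁺ʳ; ∈-map⁺; ∈-map⁻; ∈-filter⁺; ∈-cartesianProduct⁺; ∈-allFin)
open import Data.List.Membership.Propositional.Properties.WithK using (unique∧set⇒bag)
open import Data.List.Properties
  using (length-map; length-take; length-++; filter-all; filter-none; filter-++; ++-identityʳ;
        filter-accept; filter-reject; map-∘; map-tabulate; tabulate-lookup)
open import Data.List.Relation.Binary.BagAndSetEquality using (∼bag⇒↭)
open import Data.List.Relation.Binary.Permutation.Propositional using (_↭_; ↭-sym)
open import Data.List.Relation.Binary.Permutation.Propositional.Properties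
  using (↭-length; ∈-resp-↭)
open import Data.List.Relation.Unary.All as All using (All; []; _∷_)
import Data.List.Relation.Unary.All.Properties as All
open import Data.List.Relation.Unary.AllPairs as AllPairs using (AllPairs; []; _∷_)
import Data.List.Relation.Unary.AllPairs.Properties as AllPairs
open import Data.List.Relation.Unary.Any as Any using (Any; here; there)
open import Data.List.Relation.Unary.Any.Properties using (reverse⁺)
open import Data.List.Relation.Unary.Unique.Propositional using (Unique)
import Data.List.Relation.Unary.Unique.Propositional.Properties as Unique
open import Data.Maybe.Base using (Maybe; just; nothing)
import Data.Maybe.Relation.Unary.All as Maybe
open import Data.Nat.Base as ℕ using (ℕ; zero; suc; z≤n; s≤s; _∸_)
open import Data.Nat.ListAction using (sum)
open import Data.Nat.Logarithm using (⌊log₂_⌋; ⌊log₂⌋-mono-≤; ⌊log₂[2^n]⌋≡n)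
import Data.Nat.Properties as ℕ
open import Data.Nat.Solver using (module +-*-Solver)
open import Data.Product.Base using (_×_; _,_; proj₁; proj₂; Σ-syntax; ∃-syntax; ∃₂)
open import Data.Sum.Base using (inj₁; inj₂; [_,_]′)
import Data.Vec.Base as Vec
import Data.Vec.Functional as Vector
open import Data.Vec.Properties using ([]=⇒lookup; lookup⇒[]=; lookup∘tabulate)
open import Defs
open import Function.Base using (_∘_; case_of_; flip)
open import Function.Bundles using (_⇔_; mk⇔; Equivalence)
open import Function.Metric.Structures using (IsGeneralMetric)
open import Level using (Level)
open import Relation.Binary.Bundles using (DecTotalOrder; TotalOrder)
import Relation.Binary.Construct.Add.Supremum.Equality as SupremumEquality
import Relation.Binary.Construct.Add.Supremum.NonStrict as SupremumOrder
open import Relation.Binary.Core using (Rel)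
open import Relation.Binary.Definitions using (Symmetric)
open import Relation.Binary.PropositionalEquality as ≡ using (_≡_; _≢_; cong; cong₂; subst)
import Relation.Binary.Reasoning.PartialOrder as PartialOrderReasoning
open import Relation.Nullary.Construct.Add.Supremum using (_⁺; ⊤⁺; [_])
open import Relation.Nullary.Decidable
  using (Dec; yes; no; does; _×-dec_; does-⇔; decidable-stable; ¬?; toWitness; fromWitness)
open import Relation.Nullary.Negation using (¬_; contradiction)
open import Relation.Unary using (Pred; Decidable)

private
  variable
    a ℓ ℓ′ : Level
    A B C : Set a
    m : ℕ

-- Searching and counting

greatest : {P : Pred ℕ ℓ} → Decidable P → ℕ → ℕ
greatest P? zero    = zero
greatest P? (suc n) = if does (P? (suc n)) then suc n else greatest P? n

module _ {P : Pred ℕ ℓ} (P? : Decidable P) where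

  greatest-satisfies : P zero → ∀ n → P (greatest P? n)
  greatest-satisfies P0 zero = P0
  greatest-satisfies P0 (suc n) with P? (suc n)
  ... | yes Pn = Pn
  ... | no  _  = greatest-satisfies P0 n

  -- The number after the result is either one that the search rejected or `suc n`, where `Q` fails
  -- by assumption. Two predicates occur because the algorithm can test `P` (a level is full) while
  -- the analysis argues about a `Q` that it cannot test (a comparison with the unknown optimum).
  greatest-maximal : {Q : Pred ℕ ℓ′} → ∀ n → (∀ {j} → j ℕ.≤ n → Q j → P j) →
                     ¬ Q (suc n) → ¬ Q (suc (greatest P? n))
  greatest-maximal zero    _   ¬Q = ¬Q
  greatest-maximal (suc n) Q⇒P ¬Q with P? (suc n)
  ... | yes _  = ¬Q
  ... | no  ¬P = greatest-maximal n (Q⇒P ∘ ℕ.m≤n⇒m≤1+n) (¬P ∘ Q⇒P ℕ.≤-refl)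

module _ {f h : A → ℕ} (f≤h : ∀ x → f x ℕ.≤ h x) where

  sum-map-mono-≤ : ∀ xs → sum (map f xs) ℕ.≤ sum (map h xs)
  sum-map-mono-≤ []       = z≤n
  sum-map-mono-≤ (x ∷ xs) = ℕ.+-mono-≤ (f≤h x) (sum-map-mono-≤ xs)

  sum-map-mono-< : ∀ {xs} → Any (λ x → f x ℕ.< h x) xs → sum (map f xs) ℕ.< sum (map h xs)
  sum-map-mono-< {x ∷ xs} (here fx<hx) = ℕ.+-mono-<-≤ fx<hx (sum-map-mono-≤ xs)
  sum-map-mono-< {x ∷ xs} (there any)  = ℕ.+-mono-≤-< (f≤h x) (sum-map-mono-< any)

allPairs-∈ : {R : Rel A ℓ} → Symmetric R → ∀ {xs} → AllPairs R xs →
             ∀ {x y} → x ∈ xs → y ∈ xs → x ≢ y → R x y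
allPairs-∈ sym (_ ∷ _)    (here ≡.refl) (here ≡.refl) x≢y = contradiction ≡.refl x≢y
allPairs-∈ sym (Rx ∷ _)   (here ≡.refl) (there y∈xs)  _   = All.lookup Rx y∈xs
allPairs-∈ sym (Ry ∷ _)   (there x∈xs)  (here ≡.refl) _   = sym (All.lookup Ry x∈xs)
allPairs-∈ sym (_ ∷ Rxs)  (there x∈xs)  (there y∈xs)  x≢y = allPairs-∈ sym Rxs x∈xs y∈xs x≢y

-- Colour classes and cardinalities of subsets

ofColour : (A → Fin 2) → Fin 2 → List A → List A
ofColour g i = filter (λ x → g x ≟ i)

module _ (g : A → Fin 2) where

  ofColour-partition : ∀ xs → length (ofColour g 0F xs) ℕ.+ length (ofColour g 1F xs) ≡ length xs
  ofColour-partition [] = ≡.refl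
  ofColour-partition (x ∷ xs) with g x
  ... | 0F = cong suc (ofColour-partition xs)
  ... | 1F = ≡.trans (ℕ.+-suc _ _) (cong suc (ofColour-partition xs))

-- The enumeration `f` is arbitrary so that the induction can pass to `f ∘ suc` and the tail of the
-- subset.
length-filter-tabulate : {P : Pred A ℓ} (P? : Decidable P) (f : Fin m → A) (S : Subset m) →
  (∀ i → P (f i) ⇔ i ∈ˢ S) → length (filter P? (tabulate f)) ≡ ∣ S ∣
length-filter-tabulate P? f Vec.[] P⇔∈ = ≡.refl
length-filter-tabulate P? f (s Vec.∷ S) P⇔∈
  with s | P⇔∈ zero | length-filter-tabulate P? (f ∘ suc) S
         (λ i → mk⇔ (drop-there ∘ Equivalence.to (P⇔∈ (suc i))) (Equivalence.from (P⇔∈ (suc i)) ∘ Vec.there))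
... | inside  | P⇔∈₀ | ∣S∣ =
  ≡.trans (cong length (filter-accept P? (Equivalence.from P⇔∈₀ Vec.here))) (cong suc ∣S∣)
... | outside | P⇔∈₀ | ∣S∣ =
  ≡.trans (cong length (filter-reject P? (λ P → case Equivalence.to P⇔∈₀ P of λ ()))) ∣S∣

elements : Subset m → List (Fin m)
elements S = filter (_∈? S) (allFin _)

∈-elements : ∀ {S : Subset m} {x} → x ∈ elements S ⇔ x ∈ˢ S
∈-elements {S = S} = mk⇔ (proj₂ ∘ ∈-filter⁻ (_∈? S) {xs = allFin _}) (∈-filter⁺ (_∈? S) (∈-allFin _))

elements-unique : ∀ (S : Subset m) → Unique (elements S)
elements-unique S = Unique.filter⁺ (_∈? S) (Unique.allFin⁺ _)

-- Two duplicate-free lists with the same members are permutations of each other, so `xs` is as long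
-- as the canonical enumeration `elements S`.
∣∣≡length : ∀ {S : Subset m} {xs} → Unique xs → (∀ {x} → x ∈ xs ⇔ x ∈ˢ S) → ∣ S ∣ ≡ length xs
∣∣≡length {S = S} {xs} xs! xs⇔S = ≡.trans
  (≡.sym (length-filter-tabulate (_∈? S) (λ i → i) S (λ i → mk⇔ (λ i∈ → i∈) (λ i∈ → i∈))))
  (↭-length (∼bag⇒↭ (unique∧set⇒bag (elements-unique S) xs! (mk⇔
    (Equivalence.from xs⇔S ∘ Equivalence.to ∈-elements)
    (Equivalence.from ∈-elements ∘ Equivalence.to xs⇔S)))))

∈-⋃⁅⁆ : ∀ {xs : List (Fin m)} {x} → x ∈ xs ⇔ x ∈ˢ ⋃ (map ⁅_⁆ xs)
∈-⋃⁅⁆ = mk⇔ to (from _)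
  where
  to : ∀ {xs : List (Fin m)} {x} → x ∈ xs → x ∈ˢ ⋃ (map ⁅_⁆ xs)
  to (here ≡.refl) = x∈p∪q⁺ (inj₁ (x∈⁅x⁆ _))
  to (there x∈xs)  = x∈p∪q⁺ (inj₂ (to x∈xs))
  from : ∀ (xs : List (Fin m)) {x} → x ∈ˢ ⋃ (map ⁅_⁆ xs) → x ∈ xs
  from []       x∈ = contradiction x∈ ∉⊥
  from (y ∷ xs) x∈ with x∈p∪q⁻ ⁅ y ⁆ _ x∈
  ... | inj₁ x∈⁅y⁆ = here (x∈⁅y⁆⇒x≡y y x∈⁅y⁆)
  ... | inj₂ x∈⋃   = there (from xs x∈⋃)

length-ofColour-map : ∀ (f : A → B) (g : B → Fin 2) i xs →
  length (ofColour g i (map f xs)) ≡ length (ofColour (g ∘ f) i xs)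
length-ofColour-map f g i [] = ≡.refl
length-ofColour-map f g i (x ∷ xs) with does (g (f x) ≟ i)
... | true  = cong suc (length-ofColour-map f g i xs)
... | false = length-ofColour-map f g i xs

-- Powers of two and binary logarithms

n<2^n : ∀ n → n ℕ.< 2 ℕ.^ n
n<2^n zero    = s≤s z≤n
n<2^n (suc n) = begin-strict
  suc n                    <⟨ s≤s (n<2^n n) ⟩
  1 ℕ.+ 2 ℕ.^ n
    ≤⟨ ℕ.+-mono-≤ (ℕ.≤-trans (s≤s z≤n) (n<2^n n)) (ℕ.≤-reflexive (≡.sym (ℕ.+-identityʳ _))) ⟩
  2 ℕ.^ n ℕ.+ (2 ℕ.^ n ℕ.+ 0) ∎
  where open ℕ.≤-Reasoning

n≤2^[1+⌊log₂n⌋] : ∀ n → n ℕ.≤ 2 ℕ.^ suc ⌊log₂ n ⌋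
n≤2^[1+⌊log₂n⌋] n = ℕ.≮⇒≥ λ 2^[1+l]<n → ℕ.<-irrefl ≡.refl (ℕ.≤-trans
  (ℕ.≤-reflexive (≡.sym (⌊log₂[2^n]⌋≡n (suc ⌊log₂ n ⌋)))) (⌊log₂⌋-mono-≤ (ℕ.<⇒≤ 2^[1+l]<n)))

2^-cancel-≤ : ∀ m n → 2 ℕ.^ m ℕ.≤ 2 ℕ.^ n → m ℕ.≤ n
2^-cancel-≤ m n 2^m≤2^n = begin
  m                ≡⟨ ⌊log₂[2^n]⌋≡n m ⟨
  ⌊log₂ 2 ℕ.^ m ⌋  ≤⟨ ⌊log₂⌋-mono-≤ 2^m≤2^n ⟩
  ⌊log₂ 2 ℕ.^ n ⌋  ≡⟨ ⌊log₂[2^n]⌋≡n n ⟩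
  n                ∎
  where open ℕ.≤-Reasoning

-- Turns a polynomial aspect ratio into a logarithmic number of doublings. The right-hand side is at
-- most a power of two because `a < 2 ^ a` and `n ≤ 2 ^ (1 + l)`; it remains to compare exponents.
poly-log : ∀ a e n q → 2 ℕ.≤ n → 2 ℕ.^ q ℕ.≤ a ℕ.* n ℕ.^ e →
           suc q ℕ.≤ (1 ℕ.+ a ℕ.+ 2 ℕ.* e) ℕ.* ⌊log₂ n ⌋
poly-log a e n q 2≤n 2^q≤ = begin
  1 ℕ.+ q                                ≤⟨ s≤s (2^-cancel-≤ q (a ℕ.+ suc l ℕ.* e) (begin
      2 ℕ.^ q                              ≤⟨ 2^q≤ ⟩
      a ℕ.* n ℕ.^ e                        ≤⟨ ℕ.*-mono-≤ (ℕ.<⇒≤ (n<2^n a)) (ℕ.^-monoˡ-≤ e (n≤2^[1+⌊log₂n⌋] n)) ⟩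
      2 ℕ.^ a ℕ.* (2 ℕ.^ suc l) ℕ.^ e      ≡⟨ cong (2 ℕ.^ a ℕ.*_) (ℕ.^-*-assoc 2 (suc l) e) ⟩
      2 ℕ.^ a ℕ.* 2 ℕ.^ (suc l ℕ.* e)      ≡⟨ ℕ.^-distribˡ-+-* 2 a (suc l ℕ.* e) ⟨
      2 ℕ.^ (a ℕ.+ suc l ℕ.* e)            ∎)) ⟩
  1 ℕ.+ (a ℕ.+ suc l ℕ.* e)
    -- As `n` is at least 2, `l` is at least 1, so every additive constant is absorbed by a multiple
    -- of `l`.
    ≤⟨ ℕ.+-mono-≤ 1≤l (ℕ.+-mono-≤ (ℕ.m≤m*n a l {{ℕ.>-nonZero 1≤l}}) (ℕ.*-monoˡ-≤ e (ℕ.+-monoˡ-≤ l 1≤l))) ⟩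
  l ℕ.+ (a ℕ.* l ℕ.+ (l ℕ.+ l) ℕ.* e)
    ≡⟨ solve 3 (λ a e l → l :+ (a :* l :+ (l :+ l) :* e) := (con 1 :+ a :+ con 2 :* e) :* l) ≡.refl a e l ⟩
  (1 ℕ.+ a ℕ.+ 2 ℕ.* e) ℕ.* l            ∎
  where
  open ℕ.≤-Reasoning
  open +-*-Solver
  l = ⌊log₂ n ⌋
  1≤l : 1 ℕ.≤ l
  1≤l = ℕ.≤-trans (ℕ.≤-reflexive (≡.sym (⌊log₂[2^n]⌋≡n 1))) (⌊log₂⌋-mono-≤ 2≤n)

distinct-points : ∀ {n} → 2 ℕ.≤ n → ∃₂ λ (x y : Fin n) → x ≢ y
distinct-points (s≤s (s≤s _)) = 0F , 1F , λ ()

-- Ordered fields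

module OrderedFieldProperties {c ℓ₁ ℓ₂} (F : ArchimedeanOrderedField c ℓ₁ ℓ₂) where

  open ArchimedeanOrderedField F
  open Mult semiring using (×1-homo-*)
  open import Algebra.Definitions.RawSemiring (Semiring.rawSemiring semiring) public using (_^_)

  decTotalOrder : DecTotalOrder c ℓ₁ ℓ₂
  decTotalOrder = record { isDecTotalOrder = isDecTotalOrder }

  open DecTotalOrder decTotalOrder public
    using (poset; _≤?_; total; antisym)
    renaming (trans to ≤-trans; refl to ≤-refl; reflexive to ≤-reflexive)

  module ≤-Reasoning = PartialOrderReasoning poset
  open ≤-Reasoning

  ≰⇒≥ : ∀ {x y} → ¬ (x ≤ y) → y ≤ x
  ≰⇒≥ {x} {y} x≰y = [ (λ x≤y → contradiction x≤y x≰y) , (λ y≤x → y≤x) ]′ (total x y)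

  +-monoʳ-≤ : ∀ z {x y} → x ≤ y → z + x ≤ z + y
  +-monoʳ-≤ z {x} {y} x≤y = begin
    z + x ≈⟨ +-comm z x ⟩
    x + z ≤⟨ +-monoˡ-≤ z x≤y ⟩
    y + z ≈⟨ +-comm y z ⟩
    z + y ∎

  +-mono-≤ : ∀ {x y u v} → x ≤ y → u ≤ v → x + u ≤ y + v
  +-mono-≤ x≤y u≤v = ≤-trans (+-monoˡ-≤ _ x≤y) (+-monoʳ-≤ _ u≤v)

  +-cancelʳ-≤ : ∀ z {x y} → x + z ≤ y + z → x ≤ y
  +-cancelʳ-≤ z {x} {y} x+z≤y+z = begin
    x             ≈⟨ cancel x ⟨
    x + z + - z   ≤⟨ +-monoˡ-≤ (- z) x+z≤y+z ⟩
    y + z + - z   ≈⟨ cancel y ⟩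
    y             ∎
    where
    cancel : ∀ w → w + z + - z ≈ w
    cancel w = trans (+-assoc w z (- z)) (trans (+-congˡ (-‿inverseʳ z)) (+-identityʳ w))

  +-cancelˡ-≤ : ∀ z {x y} → z + x ≤ z + y → x ≤ y
  +-cancelˡ-≤ z {x} {y} z+x≤z+y = +-cancelʳ-≤ z (begin
    x + z ≈⟨ +-comm x z ⟩
    z + x ≤⟨ z+x≤z+y ⟩
    z + y ≈⟨ +-comm z y ⟩
    y + z ∎)

  *-monoˡ-≤ : ∀ {z x y} → 0# ≤ z → x ≤ y → z * x ≤ z * y
  *-monoˡ-≤ {z} {x} {y} 0≤z x≤y = +-cancelʳ-≤ (z * - x) (begin
    z * x + z * - x   ≈⟨ distribˡ z x (- x) ⟨
    z * (x + - x)     ≈⟨ *-congˡ (-‿inverseʳ x) ⟩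
    z * 0#            ≈⟨ zeroʳ z ⟩
    0#                ≤⟨ *-nonNeg 0≤z 0≤y-x ⟩
    z * (y + - x)     ≈⟨ distribˡ z y (- x) ⟩
    z * y + z * - x   ∎)
    where
    0≤y-x : 0# ≤ y + - x
    0≤y-x = begin
      0#      ≈⟨ -‿inverseʳ x ⟨
      x + - x ≤⟨ +-monoˡ-≤ (- x) x≤y ⟩
      y + - x ∎

  *-monoʳ-≤ : ∀ {z x y} → 0# ≤ z → x ≤ y → x * z ≤ y * z
  *-monoʳ-≤ {z} {x} {y} 0≤z x≤y = begin
    x * z ≈⟨ *-comm x z ⟩
    z * x ≤⟨ *-monoˡ-≤ 0≤z x≤y ⟩
    z * y ≈⟨ *-comm z y ⟩
    y * z ∎

  *-mono-≤ : ∀ {x y u v} → 0# ≤ u → 0# ≤ y → x ≤ y → u ≤ v → x * u ≤ y * v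
  *-mono-≤ 0≤u 0≤y x≤y u≤v = ≤-trans (*-monoʳ-≤ 0≤u x≤y) (*-monoˡ-≤ 0≤y u≤v)

  0≤x² : ∀ x → 0# ≤ x * x
  0≤x² x with total 0# x
  ... | inj₁ 0≤x = *-nonNeg 0≤x 0≤x
  ... | inj₂ x≤0 = +-cancelʳ-≤ (x * - x) (begin
    0# + x * - x     ≈⟨ +-identityˡ _ ⟩
    x * - x          ≈⟨ *-comm x (- x) ⟩
    - x * x          ≤⟨ *-monoˡ-≤ 0≤-x x≤0 ⟩
    - x * 0#         ≈⟨ zeroʳ (- x) ⟩
    0#               ≈⟨ zeroʳ x ⟨
    x * 0#           ≈⟨ *-congˡ (-‿inverseʳ x) ⟨
    x * (x + - x)    ≈⟨ distribˡ x x (- x) ⟩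
    x * x + x * - x  ∎)
    where
    0≤-x : 0# ≤ - x
    0≤-x = begin
      0#        ≈⟨ -‿inverseʳ x ⟨
      x + - x   ≤⟨ +-monoˡ-≤ (- x) x≤0 ⟩
      0# + - x  ≈⟨ +-identityˡ (- x) ⟩
      - x       ∎

  0≤1 : 0# ≤ 1#
  0≤1 = ≤-trans (0≤x² 1#) (≤-reflexive (*-identityˡ 1#))

  1≰0 : ¬ (1# ≤ 0#)
  1≰0 1≤0 = 0≉1 (antisym 0≤1 1≤0)

  ≤⇒≤+ : ∀ {x y z} → 0# ≤ z → x ≤ y → x ≤ y + z
  ≤⇒≤+ {x} {y} {z} 0≤z x≤y = begin
    x      ≈⟨ +-identityʳ x ⟨
    x + 0# ≤⟨ +-mono-≤ x≤y 0≤z ⟩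
    y + z  ∎

  fromℕ-nonNeg : ∀ n → 0# ≤ fromℕ n
  fromℕ-nonNeg zero    = ≤-refl
  fromℕ-nonNeg (suc n) = ≤⇒≤+ (fromℕ-nonNeg n) 0≤1

  fromℕ-mono-≤ : ∀ {m n} → m ℕ.≤ n → fromℕ m ≤ fromℕ n
  fromℕ-mono-≤ {n = n} ℕ.z≤n = fromℕ-nonNeg n
  fromℕ-mono-≤ (ℕ.s≤s m≤n)   = +-monoʳ-≤ 1# (fromℕ-mono-≤ m≤n)

  fromℕ-cancel-≤ : ∀ {m n} → fromℕ m ≤ fromℕ n → m ℕ.≤ n
  fromℕ-cancel-≤ {zero}  {n}     _ = ℕ.z≤n
  fromℕ-cancel-≤ {suc m} {zero}  p = contradiction (≤-trans (≤⇒≤+ (fromℕ-nonNeg m) ≤-refl) p) 1≰0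
  fromℕ-cancel-≤ {suc m} {suc n} p = ℕ.s≤s (fromℕ-cancel-≤ {m} {n} (+-cancelˡ-≤ 1# p))

  fromℕ-homo-* : ∀ m n → fromℕ (m ℕ.* n) ≈ fromℕ m * fromℕ n
  fromℕ-homo-* = ×1-homo-*

  <⇒≱ : ∀ {x y} → x < y → ¬ (y ≤ x)
  <⇒≱ (x≤y , x≉y) y≤x = x≉y (antisym x≤y y≤x)

  ⁻¹-inverse : ∀ {x} → 0# < x → x * x ⁻¹ ≈ 1#
  ⁻¹-inverse (_ , 0≉x) = ⁻¹-inverseʳ (0≉x ∘ sym)

  -- The inverse is `x` times the square of the inverse, a product of nonnegative factors.
  ⁻¹-nonNeg : ∀ {x} → 0# < x → 0# ≤ x ⁻¹
  ⁻¹-nonNeg {x} 0<x = begin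
    0#                   ≤⟨ *-nonNeg (proj₁ 0<x) (0≤x² (x ⁻¹)) ⟩
    x * (x ⁻¹ * x ⁻¹)    ≈⟨ *-assoc x (x ⁻¹) (x ⁻¹) ⟨
    x * x ⁻¹ * x ⁻¹      ≈⟨ *-congʳ (⁻¹-inverse 0<x) ⟩
    1# * x ⁻¹            ≈⟨ *-identityˡ (x ⁻¹) ⟩
    x ⁻¹                 ∎

  x≤y*z⇒x/z≤y : ∀ {x y z} → 0# < z → x ≤ y * z → x / z ≤ y
  x≤y*z⇒x/z≤y {x} {y} {z} 0<z x≤yz = begin
    x * z ⁻¹        ≤⟨ *-monoʳ-≤ (⁻¹-nonNeg 0<z) x≤yz ⟩
    y * z * z ⁻¹    ≈⟨ *-assoc y z (z ⁻¹) ⟩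
    y * (z * z ⁻¹)  ≈⟨ *-congˡ (⁻¹-inverse 0<z) ⟩
    y * 1#          ≈⟨ *-identityʳ y ⟩
    y               ∎

  z*x/z≈x : ∀ {z} → 0# < z → ∀ x → z * (x / z) ≈ x
  z*x/z≈x {z} 0<z x = begin-equality
    z * (x * z ⁻¹)  ≈⟨ *-congˡ (*-comm x (z ⁻¹)) ⟩
    z * (z ⁻¹ * x)  ≈⟨ *-assoc z (z ⁻¹) x ⟨
    z * z ⁻¹ * x    ≈⟨ *-congʳ (⁻¹-inverse 0<z) ⟩
    1# * x          ≈⟨ *-identityˡ x ⟩
    x               ∎

  x*y≤z⇒y≤z/x : ∀ {x y z} → 0# < x → x * y ≤ z → y ≤ z / x
  x*y≤z⇒y≤z/x {x} {y} {z} 0<x xy≤z = begin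
    y               ≈⟨ z*x/z≈x 0<x y ⟨
    x * (y * x ⁻¹)  ≈⟨ *-assoc x y (x ⁻¹) ⟨
    x * y * x ⁻¹    ≤⟨ *-monoʳ-≤ (⁻¹-nonNeg 0<x) xy≤z ⟩
    z * x ⁻¹        ∎

  1≤⇒0< : ∀ {x} → 1# ≤ x → 0# < x
  1≤⇒0< 1≤x = ≤-trans 0≤1 1≤x , λ 0≈x → 1≰0 (≤-trans 1≤x (≤-reflexive (sym 0≈x)))

  1≤x^n : ∀ {x} → 1# ≤ x → ∀ n → 1# ≤ x ^ n
  1≤x^n         1≤x zero    = ≤-refl
  1≤x^n {x = x} 1≤x (suc n) = begin
    1#         ≈⟨ *-identityˡ 1# ⟨
    1# * 1#    ≤⟨ *-mono-≤ 0≤1 (≤-trans 0≤1 1≤x) 1≤x (1≤x^n 1≤x n) ⟩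
    x * x ^ n  ∎

  -- It shows that about `1/ε` factors `1 + ε` suffice for doubling. In the inductive step
  -- `y * y ^ n` splits into `y ^ n`, covered by the induction hypothesis, and `x * y ^ n`, which is
  -- at least `x`.
  bernoulli : ∀ {x} → 0# ≤ x → ∀ n → 1# + fromℕ n * x ≤ (1# + x) ^ n
  bernoulli {x} 0≤x zero = ≤-reflexive (trans (+-congˡ (zeroˡ x)) (+-identityʳ 1#))
  bernoulli {x} 0≤x (suc n) = begin
    1# + (1# + fromℕ n) * x        ≈⟨ +-congˡ (distribʳ x 1# (fromℕ n)) ⟩
    1# + (1# * x + fromℕ n * x)    ≈⟨ +-congˡ (+-cong (*-identityˡ x) refl) ⟩
    1# + (x + fromℕ n * x)         ≈⟨ +-congˡ (+-comm x _) ⟩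
    1# + (fromℕ n * x + x)         ≈⟨ +-assoc 1# (fromℕ n * x) x ⟨
    1# + fromℕ n * x + x           ≤⟨ +-mono-≤ (bernoulli 0≤x n) x≤x*y^n ⟩
    y ^ n + x * y ^ n              ≈⟨ +-congʳ (*-identityˡ _) ⟨
    1# * y ^ n + x * y ^ n         ≈⟨ distribʳ (y ^ n) 1# x ⟨
    y * y ^ n                      ∎
    where
    y = 1# + x
    x≤x*y^n : x ≤ x * y ^ n
    x≤x*y^n = begin
      x          ≈⟨ *-identityʳ x ⟨
      x * 1#     ≤⟨ *-monoˡ-≤ 0≤x (1≤x^n (≤⇒≤+ 0≤x ≤-refl) n) ⟩
      x * y ^ n  ∎

  fromℕ-^ : ∀ {b x} → fromℕ b ≤ x → ∀ n → fromℕ (b ℕ.^ n) ≤ x ^ n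
  fromℕ-^             b≤x zero    = ≤-reflexive (+-identityʳ 1#)
  fromℕ-^ {b} {x = x} b≤x (suc n) = begin
    fromℕ (b ℕ.* b ℕ.^ n)        ≈⟨ fromℕ-homo-* b (b ℕ.^ n) ⟩
    fromℕ b * fromℕ (b ℕ.^ n)
      ≤⟨ *-mono-≤ (fromℕ-nonNeg (b ℕ.^ n)) (≤-trans (fromℕ-nonNeg b) b≤x) b≤x (fromℕ-^ b≤x n) ⟩
    x * x ^ n                    ∎

module _ {c ℓ₁ ℓ₂} (F : ArchimedeanOrderedField c ℓ₁ ℓ₂) where

  open ArchimedeanOrderedField F
  open OrderedFieldProperties F
  open Diversification F
  open SupremumOrder _≤_ using (_≤⊤⁺; [_])
  open SupremumEquality _≈_ using ([_])
  open Data.List.Extrema ≤⁺-totalOrder using (v≤min⁺; min≤xs; argmin-sel)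
  open import Algebra.Properties.Semiring.Exp semiring using (^-assocʳ)

  -- Greedy sets

  record Slot : Set c where
    constructor slot
    field
      threshold : Carrier
      colour    : Maybe (Fin 2)
      capacity  : ℕ

  open Slot

  module Greedy {A : Set} (d : A → A → Carrier) (g : A → Fin 2) where

    Spread : Carrier → List A → Set ℓ₂
    Spread γ = AllPairs (λ x y → γ ≤ d x y)

    Admits : Slot → A → Set
    Admits σ x = Maybe.All (g x ≡_) (colour σ)

    admits? : ∀ σ → Decidable (Admits σ)
    admits? σ x = Maybe.dec (g x ≟_) (colour σ)

    Accepts : Slot → A → List A → Set ℓ₂
    Accepts σ x G = Admits σ x × length G ℕ.< capacity σ × All (λ y → threshold σ ≤ d x y) G

    -- Opaque, because a reduced decision procedure is not found by `with`.
    abstract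
      accepts? : ∀ σ x G → Dec (Accepts σ x G)
      accepts? σ x G =
        admits? σ x ×-dec length G ℕ.<? capacity σ ×-dec All.all? (λ y → threshold σ ≤? d x y) G

    extend : Slot → A → List A → List A
    extend σ x G = if does (accepts? σ x G) then x ∷ G else G

    -- A right fold processes the last entry first, which fits lists whose head is the newest point.
    greedy : Slot → List A → List A
    greedy σ = foldr (extend σ) []

    Needed : List Slot → A → List A → Set _
    Needed slots x M = Any (λ σ → Accepts σ x (greedy σ M)) slots

    abstract
      needed? : ∀ slots x M → Dec (Needed slots x M)
      needed? slots x M = Any.any? (λ σ → accepts? σ x (greedy σ M)) slots

    retain : List Slot → A → List A → List A
    retain slots x M = if does (needed? slots x M) then x ∷ M else M

    -- A potential that bounds the memory: a point belonging to several greedy sets counts once for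
    -- each.
    load : List Slot → List A → ℕ
    load slots M = sum (map (λ σ → length (greedy σ M)) slots)

    module _ (σ : Slot) where

      greedy-capacity : ∀ xs → length (greedy σ xs) ℕ.≤ capacity σ
      greedy-capacity [] = z≤n
      greedy-capacity (x ∷ xs) with accepts? σ x (greedy σ xs)
      ... | yes (_ , room , _) = room
      ... | no  _              = greedy-capacity xs

      greedy-spread : ∀ xs → Spread (threshold σ) (greedy σ xs)
      greedy-spread [] = []
      greedy-spread (x ∷ xs) with accepts? σ x (greedy σ xs)
      ... | yes (_ , _ , far) = far ∷ greedy-spread xs
      ... | no  _             = greedy-spread xs

      greedy-admits : ∀ xs → All (Admits σ) (greedy σ xs)
      greedy-admits [] = []
      greedy-admits (x ∷ xs) with accepts? σ x (greedy σ xs)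
      ... | yes (admitted , _) = admitted ∷ greedy-admits xs
      ... | no  _              = greedy-admits xs

      greedy-maximal : (∀ x → ¬ (threshold σ ≤ d x x)) →
        ∀ xs → length (greedy σ xs) ℕ.< capacity σ →
        All (λ x → Admits σ x → ¬ All (λ y → threshold σ ≤ d x y) (greedy σ xs)) xs
      greedy-maximal self [] _ = []
      greedy-maximal self (x ∷ xs) room with accepts? σ x (greedy σ xs)
      ... | yes _ = (λ _ far → self x (All.head far)) ∷
                    All.map (λ near admitted → near admitted ∘ All.tail)
                      (greedy-maximal self xs (ℕ.<-trans (ℕ.n<1+n _) room))
      ... | no rejected = (λ admitted far → rejected (admitted , room , far)) ∷
                          greedy-maximal self xs room

      greedy-accept : ∀ x xs → Accepts σ x (greedy σ xs) →
                      length (greedy σ xs) ℕ.< length (greedy σ (x ∷ xs))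
      greedy-accept x xs accepted with accepts? σ x (greedy σ xs)
      ... | yes _       = ℕ.≤-refl
      ... | no rejected = contradiction accepted rejected

      greedy-reject : ∀ x xs → ¬ Accepts σ x (greedy σ xs) → greedy σ (x ∷ xs) ≡ greedy σ xs
      greedy-reject x xs rejected with accepts? σ x (greedy σ xs)
      ... | yes accepted = contradiction accepted rejected
      ... | no _         = ≡.refl

      greedy-grows : ∀ x xs → length (greedy σ xs) ℕ.≤ length (greedy σ (x ∷ xs))
      greedy-grows x xs with accepts? σ x (greedy σ xs)
      ... | yes _ = ℕ.n≤1+n _
      ... | no  _ = ℕ.≤-refl

    module _ (slots : List Slot) where

      -- A discarded point is rejected by every slot, and by `faithful` it is rejected on the full
      -- history `H` as well, where it therefore changes none of the greedy sets.
      retain-faithful : ∀ x M H → (∀ {σ} → σ ∈ slots → greedy σ M ≡ greedy σ H) →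
        ∀ {σ} → σ ∈ slots → greedy σ (retain slots x M) ≡ greedy σ (x ∷ H)
      retain-faithful x M H faithful {σ} σ∈ with needed? slots x M
      ... | yes _ = cong (extend σ x) (faithful σ∈)
      ... | no unneeded = ≡.trans
        (≡.sym (greedy-reject σ x M (λ acc → unneeded (Any.map (λ { ≡.refl → acc }) σ∈))))
        (cong (extend σ x) (faithful σ∈))

      -- Every retained point enlarges at least one of the greedy sets.
      retain-frugal : ∀ x M → length M ℕ.≤ load slots M →
        length (retain slots x M) ℕ.≤ load slots (retain slots x M)
      retain-frugal x M frugal with needed? slots x M
      ... | no  _      = frugal
      ... | yes needed = ℕ.≤-<-trans frugal
        (sum-map-mono-< (λ σ → greedy-grows σ x M)
          (Any.map (λ {σ} → greedy-accept σ x M) needed))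

      load-capacity : ∀ M → load slots M ℕ.≤ sum (map capacity slots)
      load-capacity M = sum-map-mono-≤ (λ σ → greedy-capacity σ M) slots

  -- Transport between positions and points

  module _ {A B : Set} (f : B → A) (d : A → A → Carrier) (g : A → Fin 2) where

    open Greedy d g
    private
      module Pulled = Greedy (λ i j → d (f i) (f j)) (g ∘ f)

    accepts-map : ∀ σ x G → Pulled.Accepts σ x G ⇔ Accepts σ (f x) (map f G)
    accepts-map σ x G = mk⇔
      (λ (admitted , room , far) →
        admitted , subst (ℕ._< capacity σ) (≡.sym (length-map f G)) room , All.map⁺ far)
      (λ (admitted , room , far) →
        admitted , subst (ℕ._< capacity σ) (length-map f G) room , All.map⁻ far)

    -- The algorithm addresses points by position, so it runs the greedy procedure with distances
    -- and colours pulled back along `f`. The decisions depend on these values alone and hence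
    -- commute with `f`.
    greedy-map : ∀ σ xs → map f (Pulled.greedy σ xs) ≡ greedy σ (map f xs)
    greedy-map σ [] = ≡.refl
    greedy-map σ (x ∷ xs)
      -- After these rewrites both sides branch on the same Boolean, so one case split settles both.
      rewrite ≡.sym (greedy-map σ xs)
            | ≡.sym (does-⇔ (accepts-map σ x (Pulled.greedy σ xs))
                      (Pulled.accepts? σ x (Pulled.greedy σ xs))
                      (accepts? σ (f x) (map f (Pulled.greedy σ xs))))
      with does (Pulled.accepts? σ x (Pulled.greedy σ xs))
    ... | true  = ≡.refl
    ... | false = ≡.refl

    needed-map : ∀ slots x M → Pulled.Needed slots x M ⇔ Needed slots (f x) (map f M)
    needed-map slots x M = mk⇔
      (Any.map λ {σ} → subst (Accepts σ (f x)) (greedy-map σ M) ∘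
                       Equivalence.to (accepts-map σ x _))
      (Any.map λ {σ} → Equivalence.from (accepts-map σ x _) ∘
                       subst (Accepts σ (f x)) (≡.sym (greedy-map σ M)))

    retain-map : ∀ slots x M → map f (Pulled.retain slots x M) ≡ retain slots (f x) (map f M)
    retain-map slots x M
      rewrite ≡.sym (does-⇔ (needed-map slots x M)
                      (Pulled.needed? slots x M) (needed? slots (f x) (map f M)))
      with does (Pulled.needed? slots x M)
    ... | true  = ≡.refl
    ... | false = ≡.refl

  -- Exchanging points between the two colours

  module Swap {A : Set} (d : A → A → Carrier) (g : A → Fin 2) where

    open Greedy d g

    -- Filtering by one member of `U` at a time allows each lost point of a spread list to be
    -- charged to its own `u`, as in `far-length`.
    far : Carrier → List A → List A → List A
    far γ U xs = foldr (λ u → filter (λ x → γ ≤? d x u)) xs U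

    far-all : ∀ {P : Pred A ℓ} γ U {xs} → All P xs → All P (far γ U xs)
    far-all γ []      Pxs = Pxs
    far-all γ (u ∷ U) Pxs = All.filter⁺ (λ x → γ ≤? d x u) (far-all γ U Pxs)

    far-allPairs : ∀ {R : Rel A ℓ} γ U {xs} → AllPairs R xs → AllPairs R (far γ U xs)
    far-allPairs γ []      Rxs = Rxs
    far-allPairs γ (u ∷ U) Rxs = AllPairs.filter⁺ (λ x → γ ≤? d x u) (far-allPairs γ U Rxs)

    far-distant : ∀ γ U xs → All (λ x → All (λ u → γ ≤ d x u) U) (far γ U xs)
    far-distant γ []      xs = All.universal (λ _ → []) xs
    far-distant γ (u ∷ U) xs = All.zipWith (λ (Px , Pxs) → Px ∷ Pxs)
      ( All.all-filter (λ x → γ ≤? d x u) (far γ U xs)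
      , All.filter⁺ (λ x → γ ≤? d x u) (far-distant γ U xs))

    -- Fills up xs with points of zs, in exchange for surplus points of ys.
    balance : Carrier → (kx ky : ℕ) → (xs ys zs : List A) → List A
    balance ρ kx ky xs ys zs = take ky (far ρ U ys) ++ U ++ xs
      where
      U = take (kx ∸ length xs) (far ρ xs zs)

    module _ (d-sym : ∀ x y → d x y ≈ d y x) (d-triangle : ∀ x y z → d x z ≤ d x y + d y z) where

      -- The way from `x` to `y` through `u` has length at least `γ + γ`, and its first leg is at
      -- most `γ`.
      near-near : ∀ {γ u x y} → γ + γ ≤ d x y → ¬ (γ ≤ d x u) → γ ≤ d y u
      near-near {γ} {u} {x} {y} 2γ≤dxy x-near = +-cancelˡ-≤ γ (begin
        γ + γ          ≤⟨ 2γ≤dxy ⟩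
        d x y          ≤⟨ d-triangle x u y ⟩
        d x u + d u y  ≤⟨ +-mono-≤ (≰⇒≥ x-near) (≤-reflexive (d-sym u y)) ⟩
        γ + d y u      ∎)
        where open ≤-Reasoning

      -- Two points that are 2γ apart cannot both be within γ of u.
      filter-far-length : ∀ {γ} u {xs} → Spread (γ + γ) xs →
                          length xs ℕ.≤ suc (length (filter (λ x → γ ≤? d x u) xs))
      filter-far-length u {[]} [] = z≤n
      filter-far-length {γ} u {x ∷ xs} (x-far ∷ spread) with γ ≤? d x u
      ... | yes _      = s≤s (filter-far-length u spread)
      ... | no  x-near = s≤s (ℕ.≤-reflexive (cong length (≡.sym
        (filter-all (λ y → γ ≤? d y u) (All.map (λ 2γ≤dxy → near-near 2γ≤dxy x-near) x-far)))))

      far-length : ∀ {γ} U {xs} → Spread (γ + γ) xs → length xs ℕ.≤ length U ℕ.+ length (far γ U xs)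
      far-length     []      spread = ℕ.≤-refl
      far-length {γ} (u ∷ U) {xs} spread = ℕ.≤-trans (far-length U spread)
        (ℕ.≤-trans (ℕ.+-monoʳ-≤ (length U) (filter-far-length u (far-allPairs γ U spread)))
                   (ℕ.≤-reflexive (ℕ.+-suc (length U) _)))

      -- Here `T` plays the role of the optimal solution. If the greedy set had room, no point of
      -- `T` could be `γ` away from all its members, by maximality. Each member is near to at most
      -- one point of `T`, so the set would have at least as many points as `T`, that is, at least
      -- `cap`.
      greedy-full : ∀ {γ κ cap} → (∀ x → ¬ (γ ≤ d x x)) →
        ∀ {H T} → All (_∈ H) T → Spread (γ + γ) T → All (Admits (slot γ κ cap)) T → cap ℕ.≤ length T →
        length (greedy (slot γ κ cap) H) ≡ cap
      greedy-full {γ} {κ} {cap} self {H} {T} T⊆H spread admitted cap≤T =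
        ℕ.≤-antisym (greedy-capacity σ H) (ℕ.≮⇒≥ λ room → ℕ.<⇒≱ room (ℕ.≤-trans cap≤T (covered room)))
        where
        σ = slot γ κ cap
        G = greedy σ H
        covered : length G ℕ.< cap → length T ℕ.≤ length G
        covered room with far γ G T | far-length G spread | far-distant γ G T
                        | far-all γ G T⊆H | far-all γ G admitted
        ... | []    | T≤G | _           | _       | _      = ℕ.≤-trans T≤G (ℕ.≤-reflexive (ℕ.+-identityʳ _))
        ... | x ∷ _ | _   | x-far ∷ _   | x∈H ∷ _ | ok ∷ _ =
          contradiction x-far (All.lookup (greedy-maximal σ self H room) x∈H ok)

      module _ {ρ : Carrier} (kx ky : ℕ) {xs ys zs : List A}
        (xs-spread : Spread (ρ + ρ) xs) (ys-spread : Spread (ρ + ρ) ys) (zs-spread : Spread (ρ + ρ) zs)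
        (0≤ρ : 0# ≤ ρ)
        where

        private
          weaken : ∀ {x} → ρ + ρ ≤ x → ρ ≤ x
          weaken = ≤-trans (≤⇒≤+ 0≤ρ ≤-refl)
          U = take (kx ∸ length xs) (far ρ xs zs)
          D = take ky (far ρ U ys)

        -- Inside each of the three lists the distances are at least `ρ + ρ`. Between them, `U` was
        -- filtered against `xs` and `D` against `U`, while `D` and `xs` are apart by hypothesis,
        -- since `D` is taken from `ys`.
        balance-spread : All (λ x → All (λ y → ρ ≤ d x y) xs) ys → Spread ρ (balance ρ kx ky xs ys zs)
        balance-spread ys-xs = AllPairs.++⁺ D-spread (AllPairs.++⁺ U-spread (AllPairs.map weaken xs-spread) U-xs)
          (All.zipWith (λ (dU , dA) → All.++⁺ dU dA)
            (All.take⁺ ky (far-distant ρ U ys) , All.take⁺ ky (far-all ρ U ys-xs)))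
          where
          U-spread : Spread ρ U
          U-spread = AllPairs.take⁺ _ (far-allPairs ρ xs (AllPairs.map weaken zs-spread))
          D-spread : Spread ρ D
          D-spread = AllPairs.take⁺ _ (far-allPairs ρ U (AllPairs.map weaken ys-spread))
          U-xs : All (λ x → All (λ y → ρ ≤ d x y) xs) U
          U-xs = All.take⁺ _ (far-distant ρ xs zs)

        module _ (xs≤kx : length xs ℕ.≤ kx) (kx≤zs : kx ℕ.≤ length zs) where

          -- Each point of `xs` spoils at most one point of `zs`, so at least `kx ∸ length xs`
          -- candidates survive.
          length-U : length U ≡ kx ∸ length xs
          length-U = ≡.trans (length-take _ (far ρ xs zs)) (ℕ.m≤n⇒m⊓n≡m
            (ℕ.m≤n+o⇒m∸n≤o kx (length xs) (ℕ.≤-trans kx≤zs (far-length xs zs-spread))))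

          length-U++xs : length (U ++ xs) ≡ kx
          length-U++xs = ≡.trans (length-++ U) (≡.trans (cong (ℕ._+ length xs) length-U) (ℕ.m∸n+n≡m xs≤kx))

          -- Each point of `U` spoils at most one point of `ys`. The loss is thus at most the
          -- deficit `kx ∸ length xs`, and by `enough` the surplus of `ys` over `ky` makes up for
          -- it.
          length-D : kx ℕ.+ ky ℕ.≤ length xs ℕ.+ length ys → length D ≡ ky
          length-D enough = ≡.trans (length-take _ (far ρ U ys)) (ℕ.m≤n⇒m⊓n≡m
            (ℕ.+-cancelˡ-≤ kx _ _ (begin
              kx ℕ.+ ky                                            ≤⟨ enough ⟩
              length xs ℕ.+ length ys
                ≤⟨ ℕ.+-monoʳ-≤ (length xs) (far-length U ys-spread) ⟩
              length xs ℕ.+ (length U ℕ.+ length (far ρ U ys))       ≡⟨ ℕ.+-assoc (length xs) (length U) _ ⟨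
              length xs ℕ.+ length U ℕ.+ length (far ρ U ys)
                ≡⟨ cong (λ u → length xs ℕ.+ u ℕ.+ length (far ρ U ys)) length-U ⟩
              length xs ℕ.+ (kx ∸ length xs) ℕ.+ length (far ρ U ys)
                ≡⟨ cong (ℕ._+ length (far ρ U ys)) (ℕ.m+[n∸m]≡n xs≤kx) ⟩
              kx ℕ.+ length (far ρ U ys)                            ∎)))
            where open ℕ.≤-Reasoning

          module _ {cx cy : Fin 2} (cx≢cy : cx ≢ cy) (xs-cx : All (λ x → g x ≡ cx) xs)
            (ys-cy : All (λ x → g x ≡ cy) ys) (zs-cx : All (λ x → g x ≡ cx) zs)
            where

            private
              D-cy : All (λ x → g x ≡ cy) D
              D-cy = All.take⁺ ky (far-all ρ U ys-cy)
              U++xs-cx : All (λ x → g x ≡ cx) (U ++ xs)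
              U++xs-cx = All.++⁺ (All.take⁺ _ (far-all ρ xs zs-cx)) xs-cx

            balance-colourˡ : length (ofColour g cx (balance ρ kx ky xs ys zs)) ≡ kx
            balance-colourˡ = ≡.trans (cong length (≡.trans (filter-++ _ D (U ++ xs)) (cong₂ _++_
              (filter-none _ (All.map (λ gx≡cy gx≡cx → cx≢cy (≡.trans (≡.sym gx≡cx) gx≡cy)) D-cy))
              (filter-all _ U++xs-cx)))) length-U++xs

            balance-colourʳ : kx ℕ.+ ky ℕ.≤ length xs ℕ.+ length ys →
                              length (ofColour g cy (balance ρ kx ky xs ys zs)) ≡ ky
            balance-colourʳ enough = ≡.trans (cong length (≡.trans (filter-++ _ D (U ++ xs))
              (≡.trans (cong₂ _++_
                (filter-all _ D-cy)
                (filter-none _ (All.map (λ gx≡cx gx≡cy → cx≢cy (≡.trans (≡.sym gx≡cx) gx≡cy)) U++xs-cx)))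
                (++-identityʳ D)))) (length-D enough)

  -- Choosing a level

  module Selection (k : Fin 2 → ℕ) (radius : ℕ → Carrier) where

    kinds : List (Maybe (Fin 2))
    kinds = nothing ∷ just 0F ∷ just 1F ∷ []

    quota : Maybe (Fin 2) → ℕ
    quota nothing  = k 0F ℕ.+ k 1F
    quota (just i) = k i

    level : ℕ → Maybe (Fin 2) → Slot
    level j q = slot (radius j + radius j) q (quota q)

    slots : ℕ → List Slot
    slots zero    = []
    slots (suc j) = map (level j) kinds ++ slots j

    ∈-kinds : ∀ q → q ∈ kinds
    ∈-kinds nothing   = here ≡.refl
    ∈-kinds (just 0F) = there (here ≡.refl)
    ∈-kinds (just 1F) = there (there (here ≡.refl))

    ∈-slots : ∀ {n j} q → j ℕ.< n → level j q ∈ slots n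
    ∈-slots {suc n} {j} q j<1+n with ℕ.m<1+n⇒m<n∨m≡n j<1+n
    ... | inj₁ j<n    = ∈-++⁺ʳ (map (level n) kinds) (∈-slots q j<n)
    ... | inj₂ ≡.refl = ∈-++⁺ˡ (∈-map⁺ (level n) (∈-kinds q))

    -- A level contributes the full size for the colour-blind set and once more the full size for
    -- the two monochromatic sets together.
    slots-capacity : ∀ n → sum (map capacity (slots n)) ≡ n ℕ.* (2 ℕ.* (k 0F ℕ.+ k 1F))
    slots-capacity zero = ≡.refl
    slots-capacity (suc n) = ≡.trans
      (cong (λ s → k 0F ℕ.+ k 1F ℕ.+ (k 0F ℕ.+ (k 1F ℕ.+ s))) (slots-capacity n))
      (solve 3 (λ x y s → x :+ y :+ (x :+ (y :+ s)) := con 2 :* (x :+ y) :+ s) ≡.refl (k 0F) (k 1F) _)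
      where open +-*-Solver

    module Choice {A : Set} (d : A → A → Carrier) (g : A → Fin 2) where

      open Greedy d g
      open Swap d g

      Full : List A → ℕ → Set
      Full M j = All (λ q → length (greedy (level j q) M) ≡ quota q) kinds

      full? : ∀ M → Decidable (Full M)
      full? M j = All.all? (λ q → length (greedy (level j q) M) ℕ.≟ quota q) kinds

      diverse : ℕ → List A → List A
      diverse j M = greedy (level j nothing) M

      monochromatic : ℕ → Fin 2 → List A → List A
      monochromatic j i M = greedy (level j (just i)) M

      rebalance : ℕ → (i i′ : Fin 2) → List A → List A
      rebalance j i i′ M = balance (radius j) (k i) (k i′)
        (ofColour g i (diverse j M)) (ofColour g i′ (diverse j M)) (monochromatic j i M)

      select : ℕ → List A → List A
      select j M with length (ofColour g 0F (diverse j M)) ℕ.≤? k 0F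
      ... | yes _ = rebalance j 0F 1F M
      ... | no  _ = rebalance j 1F 0F M

      module _ (d-sym : ∀ x y → d x y ≈ d y x) (d-triangle : ∀ x y z → d x z ≤ d x y + d y z) where

        module _ (j : ℕ) (M : List A) (0≤r : 0# ≤ radius j) (full : Full M j) where

          private
            S = diverse j M
            Sᶜ = λ i → ofColour g i S

            length-S : length (Sᶜ 0F) ℕ.+ length (Sᶜ 1F) ≡ k 0F ℕ.+ k 1F
            length-S = ≡.trans (ofColour-partition g S) (All.lookup full (∈-kinds nothing))

            mono-length : ∀ i → k i ℕ.≤ length (monochromatic j i M)
            mono-length i = ℕ.≤-reflexive (≡.sym (All.lookup full (∈-kinds (just i))))

            mono-colour : ∀ i → All (λ x → g x ≡ i) (monochromatic j i M)
            mono-colour i = All.map Maybe.drop-just (greedy-admits (level j (just i)) M)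

            S-spread : Spread (radius j + radius j) S
            S-spread = greedy-spread (level j nothing) M

            Sᶜ-spread : ∀ i → Spread (radius j + radius j) (Sᶜ i)
            Sᶜ-spread i = AllPairs.filter⁺ (λ x → g x ≟ i) S-spread

            Sᶜ-colour : ∀ i → All (λ x → g x ≡ i) (Sᶜ i)
            Sᶜ-colour i = All.all-filter (λ x → g x ≟ i) S

            -- Points of different colours are distinct members of the same spread set `S`.
            cross : ∀ {i i′} → i ≢ i′ → All (λ x → All (λ y → radius j ≤ d x y) (Sᶜ i)) (Sᶜ i′)
            cross {i} {i′} i≢i′ = All.tabulate λ {x} x∈ → All.tabulate λ {y} y∈ →
              let x∈S , gx≡i′ = ∈-filter⁻ (λ x → g x ≟ i′) {xs = S} x∈
                  y∈S , gy≡i  = ∈-filter⁻ (λ x → g x ≟ i) {xs = S} y∈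
              in ≤-trans (≤⇒≤+ 0≤r ≤-refl) (allPairs-∈
                   (λ {x} {y} far → ≤-trans far (≤-reflexive (d-sym x y))) S-spread x∈S y∈S
                   (λ { ≡.refl → i≢i′ (≡.trans (≡.sym gy≡i) gx≡i′) }))

            rebalance-spread : ∀ {i i′} → i ≢ i′ → Spread (radius j) (rebalance j i i′ M)
            rebalance-spread {i} {i′} i≢i′ = balance-spread d-sym d-triangle (k i) (k i′)
              (Sᶜ-spread i) (Sᶜ-spread i′) (greedy-spread (level j (just i)) M) 0≤r (cross i≢i′)

            module _ {i i′ : Fin 2} (i≢i′ : i ≢ i′) (under : length (Sᶜ i) ℕ.≤ k i) where

              rebalance-colourˡ : length (ofColour g i (rebalance j i i′ M)) ≡ k i
              rebalance-colourˡ = balance-colourˡ d-sym d-triangle (k i) (k i′)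
                (Sᶜ-spread i) (Sᶜ-spread i′) (greedy-spread (level j (just i)) M) 0≤r
                under (mono-length i) i≢i′ (Sᶜ-colour i) (Sᶜ-colour i′) (mono-colour i)

              rebalance-colourʳ : k i ℕ.+ k i′ ℕ.≤ length (Sᶜ i) ℕ.+ length (Sᶜ i′) →
                                  length (ofColour g i′ (rebalance j i i′ M)) ≡ k i′
              rebalance-colourʳ = balance-colourʳ d-sym d-triangle (k i) (k i′)
                (Sᶜ-spread i) (Sᶜ-spread i′) (greedy-spread (level j (just i)) M) 0≤r
                under (mono-length i) i≢i′ (Sᶜ-colour i) (Sᶜ-colour i′) (mono-colour i)

            -- The two classes have `k 0F + k 1F` points in total, so an excess in one colour is a
            -- deficit in the other.
            under₁ : ¬ (length (Sᶜ 0F) ℕ.≤ k 0F) → length (Sᶜ 1F) ℕ.≤ k 1F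
            under₁ over = ℕ.+-cancelˡ-≤ (k 0F) _ _ (ℕ.≤-trans
              (ℕ.+-monoˡ-≤ (length (Sᶜ 1F)) (ℕ.<⇒≤ (ℕ.≰⇒> over))) (ℕ.≤-reflexive length-S))

          select-spread : Spread (radius j) (select j M)
          select-spread with length (ofColour g 0F (diverse j M)) ℕ.≤? k 0F
          ... | yes _ = rebalance-spread λ ()
          ... | no  _ = rebalance-spread λ ()

          select-colour : ∀ i → length (ofColour g i (select j M)) ≡ k i
          select-colour i with length (ofColour g 0F (diverse j M)) ℕ.≤? k 0F
          select-colour 0F | yes under = rebalance-colourˡ (λ ()) under
          select-colour 1F | yes under = rebalance-colourʳ (λ ()) under (ℕ.≤-reflexive (≡.sym length-S))
          select-colour 0F | no  over  = rebalance-colourʳ (λ ()) (under₁ over)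
            (ℕ.≤-reflexive (≡.trans (ℕ.+-comm (k 1F) (k 0F))
              (≡.trans (≡.sym length-S) (ℕ.+-comm (length (Sᶜ 0F)) (length (Sᶜ 1F))))))
          select-colour 1F | no  over  = rebalance-colourˡ (λ ()) (under₁ over)

        -- `T` itself forces the colour-blind set to be full, and each colour class of `T` forces
        -- the monochromatic set of that colour.
        full-level : ∀ {j} → (∀ x → ¬ (radius j + radius j ≤ d x x)) → ∀ {T M} → All (_∈ M) T →
          Spread ((radius j + radius j) + (radius j + radius j)) T →
          (∀ i → k i ℕ.≤ length (ofColour g i T)) → Full M j
        full-level {j} self {T} {M} T⊆M T-spread enough = diverse-full ∷ mono-full 0F ∷ mono-full 1F ∷ []
          where
          diverse-full : length (diverse j M) ≡ quota nothing
          diverse-full = greedy-full d-sym d-triangle self T⊆M T-spread (All.universal (λ _ → Maybe.nothing) T)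
            (ℕ.≤-trans (ℕ.+-mono-≤ (enough 0F) (enough 1F)) (ℕ.≤-reflexive (ofColour-partition g T)))

          mono-full : ∀ i → length (monochromatic j i M) ≡ k i
          mono-full i = greedy-full d-sym d-triangle self
            (All.filter⁺ (λ x → g x ≟ i) T⊆M) (AllPairs.filter⁺ (λ x → g x ≟ i) T-spread)
            (All.map Maybe.just (All.all-filter (λ x → g x ≟ i) T)) (enough i)

  -- The streaming run

  module InstanceProperties (I : Instance 2) where

    open Instance I

    module _ (S : Subset n) where

      private
        pairs = cartesianProduct (allFin n) (allFin n)

        distinct? : Decidable (λ ((u , v) : Fin n × Fin n) → u ∈ˢ S × v ∈ˢ S × u ≢ v)
        distinct? (u , v) = (u ∈? S) ×-dec (v ∈? S) ×-dec ¬? (u ≟ v)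

        distance : Fin n × Fin n → Carrier ⁺
        distance (u , v) = [ d u v ]

      ≤-div : ∀ {b} → (∀ {u v} → u ∈ˢ S → v ∈ˢ S → u ≢ v → b ≤⁺ [ d u v ]) → b ≤⁺ div S
      ≤-div b≤d = v≤min⁺ (_ ≤⊤⁺) (All.map⁺ (All.tabulate λ uv∈ →
        let _ , u∈S , v∈S , u≢v = ∈-filter⁻ distinct? {xs = pairs} uv∈
        in b≤d u∈S v∈S u≢v))

      div-≤ : ∀ {u v} → u ∈ˢ S → v ∈ˢ S → u ≢ v → div S ≤⁺ [ d u v ]
      div-≤ {u} {v} u∈S v∈S u≢v = All.lookup (min≤xs ⊤⁺ _) (∈-map⁺ distance
        (∈-filter⁺ distinct? (∈-cartesianProduct⁺ (∈-allFin u) (∈-allFin v)) (u∈S , v∈S , u≢v)))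

      -- The minimum is either its default `⊤⁺` or an entry of the list of distances. This lets a
      -- finite optimum be bounded by `hi`.
      div-attained : ∀ {ℓ} → div S ≈⁺ [ ℓ ] → ∃₂ λ u v → u ≢ v × d u v ≈ ℓ
      div-attained {ℓ} div≈ℓ with argmin-sel (λ x → x) ⊤⁺ (map distance (filter distinct? pairs))
      ... | inj₁ div≡⊤ = case subst (_≈⁺ [ ℓ ]) div≡⊤ div≈ℓ of λ ()
      ... | inj₂ div∈  with (u , v) , uv∈ , div≡ ← ∈-map⁻ distance {xs = filter distinct? pairs} div∈
                       with _ , _ , _ , u≢v ← ∈-filter⁻ distinct? {xs = pairs} uv∈
                       with [ duv≈ℓ ] ← subst (_≈⁺ [ ℓ ]) div≡ div≈ℓ = u , v , u≢v , duv≈ℓ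

    ∈-𝒳 : ∀ {x i} → x ∈ˢ 𝒳 i ⇔ group x ≡ i
    ∈-𝒳 {x} {i} = mk⇔
      (λ x∈ → toWitness (subst T (≡.sym (≡.trans (≡.sym (lookup∘tabulate _ x)) ([]=⇒lookup x∈))) _))
      (λ gx≡i → lookup⇒[]= x _ (≡.trans (lookup∘tabulate _ x) (Equivalence.to T-≡ (fromWitness gx≡i))))

    ∣∩𝒳∣≡length : ∀ {S xs} → Unique xs → (∀ {x} → x ∈ xs ⇔ x ∈ˢ S) →
                  ∀ i → ∣ S ∩ 𝒳 i ∣ ≡ length (ofColour group i xs)
    ∣∩𝒳∣≡length {S} {xs} xs! xs⇔S i = ∣∣≡length (Unique.filter⁺ (λ x → group x ≟ i) xs!) (mk⇔
      (λ x∈ → let x∈xs , gx≡i = ∈-filter⁻ (λ x → group x ≟ i) {xs = xs} x∈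
              in x∈p∩q⁺ (Equivalence.to xs⇔S x∈xs , Equivalence.from ∈-𝒳 gx≡i))
      (λ x∈ → let x∈S , x∈𝒳 = x∈p∩q⁻ S (𝒳 i) x∈
              in ∈-filter⁺ (λ x → group x ≟ i) (Equivalence.from xs⇔S x∈S) (Equivalence.to ∈-𝒳 x∈𝒳)))

  module _ (k : Fin 2 → ℕ) (radius : ℕ → Carrier) (top : ℕ) where

    open Selection k radius

    -- Memory is ordered from the newest to the oldest point; all tags are equal.
    streaming : StreamingAlgorithm 2
    streaming = record
      { tags   = 1
      ; step   = λ _ d g → map (0F ,_) (Greedy.retain d g (slots (suc top)) 0F (tabulate suc))
      ; output = λ {s} _ d g → let open Choice d g in
                 select (greatest (full? (allFin s)) top) (allFin s)
      }

  -- Space and quality of a run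

  module Analysis (I : Instance 2) (radius : ℕ → Carrier) (top : ℕ) where

    open Instance I
    open InstanceProperties I
    open Run (streaming k radius top) I
    open Selection k radius
    open Greedy d group
    open Choice d group
    open IsGeneralMetric isMetric using (triangle; ≈⇒0) renaming (sym to d-sym)

    points : Memory → List (Fin n)
    points = map proj₂

    -- Since `p` sends position zero to the arriving point and the remaining positions to the cells
    -- in order, the step on positions becomes `retain` on the points themselves.
    points-receive : ∀ M x → points (receive M x) ≡ retain (slots (suc top)) x (points M)
    points-receive M x = begin
      map proj₂ (map (λ (t , i) → t , p i) (map (0F ,_) kept))       ≡⟨ map-∘ _ ⟨
      map (p ∘ proj₂) (map (0F ,_) kept)                             ≡⟨ map-∘ _ ⟨
      map p kept
        ≡⟨ retain-map p d group (slots (suc top)) 0F (tabulate suc) ⟩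
      retain (slots (suc top)) x (map p (tabulate suc))
        ≡⟨ cong (retain (slots (suc top)) x) (≡.trans (map-tabulate suc p) (≡.sym (map-tabulate (List.lookup M) proj₂))) ⟩
      retain (slots (suc top)) x (map proj₂ (tabulate (List.lookup M)))
        ≡⟨ cong (retain (slots (suc top)) x ∘ map proj₂) (tabulate-lookup M) ⟩
      retain (slots (suc top)) x (points M)                            ∎
      where
      open ≡.≡-Reasoning
      p = x Vector.∷ cellPoints M
      kept = Greedy.retain (λ i j → d (p i) (p j)) (group ∘ p) (slots (suc top)) 0F (tabulate suc)

    Faithful : Memory → List (Fin n) → Set c
    Faithful M H = ∀ {σ} → σ ∈ slots (suc top) → greedy σ (points M) ≡ greedy σ H

    -- The history `H` gains each new point at its head; started from the empty list it becomes the
    -- reversed stream, in the same order as the memory.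
    foldl-faithful : ∀ xs {M H} → Faithful M H → Faithful (foldl receive M xs) (foldl (flip _∷_) H xs)
    foldl-faithful []       faithful = faithful
    foldl-faithful (x ∷ xs) {M} {H} faithful = foldl-faithful xs λ {σ} σ∈ →
      ≡.trans (cong (greedy σ) (points-receive M x)) (retain-faithful _ x (points M) H faithful σ∈)

    foldl-frugal : ∀ xs {M} → length (points M) ℕ.≤ load (slots (suc top)) (points M) →
                   length (points (foldl receive M xs)) ℕ.≤ load (slots (suc top)) (points (foldl receive M xs))
    foldl-frugal []       frugal = frugal
    foldl-frugal (x ∷ xs) {M} frugal = foldl-frugal xs
      (subst (λ M → length M ℕ.≤ load (slots (suc top)) M) (≡.sym (points-receive M x))
        (retain-frugal (slots (suc top)) x (points M) frugal))

    space-≤ : ∀ stream → space stream ℕ.≤ suc top ℕ.* (2 ℕ.* (k 0F ℕ.+ k 1F))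
    space-≤ stream = maxℕ≤v⁺ z≤n (All.map⁺ (All.universal bound (inits stream)))
      where
      open ℕ.≤-Reasoning
      bound : ∀ xs → length (memoryAfter xs) ℕ.≤ suc top ℕ.* (2 ℕ.* (k 0F ℕ.+ k 1F))
      bound xs = begin
        length (memoryAfter xs)                             ≡⟨ length-map proj₂ (memoryAfter xs) ⟨
        length (points (memoryAfter xs))                    ≤⟨ foldl-frugal xs z≤n ⟩
        load (slots (suc top)) (points (memoryAfter xs))
          ≤⟨ load-capacity (slots (suc top)) (points (memoryAfter xs)) ⟩
        sum (map Slot.capacity (slots (suc top)))           ≡⟨ slots-capacity (suc top) ⟩
        suc top ℕ.* (2 ℕ.* (k 0F ℕ.+ k 1F))                 ∎

    module _ (r>0 : ∀ j → ¬ (radius j ≤ 0#))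
      (base : ∀ {x y} → x ≢ y → (radius 0 + radius 0) + (radius 0 + radius 0) ≤ d x y)
      (stream : List (Fin n)) (complete : stream ↭ allFin n)
      where

      private
        M : Memory
        M = memoryAfter stream

        H : List (Fin n)
        H = reverse stream

        p : Fin (length M) → Fin n
        p = cellPoints M

        module Stored = Choice (λ i j → d (p i) (p j)) (group ∘ p)

        r≥0 : ∀ j → 0# ≤ radius j
        r≥0 j = ≰⇒≥ (r>0 j)

        positions : map p (allFin (length M)) ≡ points M
        positions = ≡.trans (map-tabulate (λ i → i) p)
          (≡.trans (≡.sym (map-tabulate (List.lookup M) proj₂)) (cong points (tabulate-lookup M)))

        ∈-H : ∀ x → x ∈ H
        ∈-H x = reverse⁺ (∈-resp-↭ (↭-sym complete) (∈-allFin x))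

        self-near : ∀ j x → ¬ (radius j + radius j ≤ d x x)
        self-near j x far = r>0 j (≤-trans (≤⇒≤+ (r≥0 j) ≤-refl) (≤-trans far (≤-reflexive (≈⇒0 ≡.refl))))

        -- Connects the fullness that the algorithm tests, on positions in the memory, with fullness
        -- on the whole stream. The bound on `j` says that the slots of the level were among those
        -- maintained.
        full-stored : ∀ {j} → j ℕ.≤ top → Full H j → Stored.Full (allFin (length M)) j
        full-stored {j} j≤top = All.map λ {q} → ≡.trans (begin
          length (greedyₚ (level j q) (allFin (length M)))
            ≡⟨ length-map p (greedyₚ (level j q) (allFin (length M))) ⟨
          length (map p (greedyₚ (level j q) (allFin (length M))))
            ≡⟨ cong length (greedy-map p d group (level j q) (allFin (length M))) ⟩
          length (greedy (level j q) (map p (allFin (length M))))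
            ≡⟨ cong (length ∘ greedy (level j q)) positions ⟩
          length (greedy (level j q) (points M))
            ≡⟨ cong length (foldl-faithful stream (λ _ → ≡.refl) (∈-slots q (s≤s j≤top))) ⟩
          length (greedy (level j q) H)                           ∎)
          where
          open ≡.≡-Reasoning
          open Greedy (λ i j → d (p i) (p j)) (group ∘ p) using () renaming (greedy to greedyₚ)

        -- An inequality for the colour counts lets `S` be either a feasible solution or the set of
        -- all points.
        full : ∀ {S j} → (∀ i → k i ℕ.≤ ∣ S ∩ 𝒳 i ∣) →
          (∀ {u v} → u ∈ˢ S → v ∈ˢ S → u ≢ v → (radius j + radius j) + (radius j + radius j) ≤ d u v) →
          j ℕ.≤ top → Stored.Full (allFin (length M)) j
        full {S} {j} enough separated j≤top = full-stored j≤top (full-level d-sym triangle (self-near j)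
          {elements S} (All.tabulate (λ {x} _ → ∈-H x))
          (spread (elements-unique S) (All.tabulate (Equivalence.to ∈-elements)))
          (λ i → ℕ.≤-trans (enough i) (ℕ.≤-reflexive (∣∩𝒳∣≡length (elements-unique S) ∈-elements i))))
          where
          spread : ∀ {xs} → Unique xs → All (_∈ˢ S) xs → Spread ((radius j + radius j) + (radius j + radius j)) xs
          spread []           []             = []
          spread (x∉xs ∷ xs!) (x∈S ∷ xs⊆S) =
            All.zipWith (λ (x≢y , y∈S) → separated x∈S y∈S x≢y) (x∉xs , xs⊆S) ∷ spread xs! xs⊆S

        -- By `base` the set of all points is separated by four times the smallest radius, and it
        -- has enough points of each colour. This justifies 0 as the untested default of `greatest`.
        full₀ : Stored.Full (allFin (length M)) 0
        full₀ = full {⊤} (λ i → subst (λ S → k i ℕ.≤ ∣ S ∣) (≡.sym (∩-identityˡ (𝒳 i))) (k≤∣𝒳∣ i))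
                     (λ _ _ → base) z≤n

        chosen : ℕ
        chosen = greatest (Stored.full? (allFin (length M))) top

        chosen-full : Stored.Full (allFin (length M)) chosen
        chosen-full = greatest-satisfies (Stored.full? (allFin (length M))) full₀ top

        selected : List (Fin n)
        selected = map p (Stored.select chosen (allFin (length M)))

        selected-spread : Spread (radius chosen) selected
        selected-spread = AllPairs.map⁺ (Stored.select-spread
          (λ i j → d-sym (p i) (p j)) (λ i j k → triangle (p i) (p j) (p k))
          chosen (allFin (length M)) (r≥0 chosen) chosen-full)

        -- A positive mutual distance excludes repetitions, so counting the list counts the returned
        -- subset.
        selected-unique : Unique selected
        selected-unique = AllPairs.map
          (λ { far ≡.refl → r>0 chosen (≤-trans far (≤-reflexive (≈⇒0 ≡.refl))) }) selected-spread

        selected-colour : ∀ i → length (ofColour group i selected) ≡ k i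
        selected-colour i = ≡.trans (length-ofColour-map p group i (Stored.select chosen (allFin (length M))))
          (Stored.select-colour (λ i j → d-sym (p i) (p j)) (λ i j k → triangle (p i) (p j) (p k))
            chosen (allFin (length M)) (r≥0 chosen) chosen-full i)

        ∈-result : ∀ {x} → x ∈ selected ⇔ x ∈ˢ result stream
        ∈-result {x} = subst (λ S → x ∈ selected ⇔ x ∈ˢ S)
          (cong ⋃ (≡.sym (map-∘ (Stored.select chosen (allFin (length M)))))) ∈-⋃⁅⁆

      result-feasible : Feasible (result stream)
      result-feasible i = ≡.trans (∣∩𝒳∣≡length selected-unique ∈-result i) (selected-colour i)

      -- As long as four times a radius is at most `ℓ`, the solution `S` forces that level to be
      -- full. The level after the chosen one is either not full or lies beyond `top`, so its radius
      -- violates the inequality.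
      result-diverse : ∀ {S ℓ} → Feasible S →
        (∀ {u v} → u ∈ˢ S → v ∈ˢ S → u ≢ v → ℓ ≤ d u v) →
        ¬ ((radius (suc top) + radius (suc top)) + (radius (suc top) + radius (suc top)) ≤ ℓ) →
        ∃[ j ] (¬ ((radius (suc j) + radius (suc j)) + (radius (suc j) + radius (suc j)) ≤ ℓ) ×
                [ radius j ] ≤⁺ div (result stream))
      result-diverse {S} {ℓ} feasible separated ¬top = chosen ,
        greatest-maximal (Stored.full? (allFin (length M)))
          {Q = λ j → (radius j + radius j) + (radius j + radius j) ≤ ℓ} top
          (λ j≤top 4r≤ℓ → full {S} (ℕ.≤-reflexive ∘ ≡.sym ∘ feasible)
            (λ u∈ v∈ u≢v → ≤-trans 4r≤ℓ (separated u∈ v∈ u≢v)) j≤top) ¬top ,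
        ≤-div (result stream) (λ u∈ v∈ u≢v → [ allPairs-∈
          (λ {x} {y} far → ≤-trans far (≤-reflexive (d-sym x y))) selected-spread
          (Equivalence.from ∈-result u∈) (Equivalence.from ∈-result v∈) u≢v ])

      -- The case of infinite diversity. Feasibility gives the result as many points as `S`, hence
      -- at most one, and no pair is left to be compared.
      result-trivial : ∀ {S} → Feasible S → (∀ {u v} → u ∈ˢ S → v ∈ˢ S → ¬ (u ≢ v)) →
                       ⊤⁺ ≤⁺ div (result stream)
      result-trivial {S} feasible single = ≤-div (result stream) (λ u∈ v∈ u≢v → contradiction
        (≤1 (Equivalence.from ∈-result u∈) (Equivalence.from ∈-result v∈) u≢v) (ℕ.≤⇒≯ selected≤1))
        where
        elements≤1 : ∀ {xs} → Unique xs → All (_∈ˢ S) xs → length xs ℕ.≤ 1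
        elements≤1 {[]}         _                 _               = z≤n
        elements≤1 {_ ∷ []}     _                 _               = s≤s z≤n
        elements≤1 {_ ∷ _ ∷ _} ((x≢y ∷ _) ∷ _) (x∈ ∷ y∈ ∷ _) = contradiction x≢y (single x∈ y∈)

        ≤1 : ∀ {xs : List (Fin n)} {u v} → u ∈ xs → v ∈ xs → u ≢ v → 1 ℕ.< length xs
        ≤1 (here ≡.refl) (here ≡.refl) u≢v = contradiction ≡.refl u≢v
        ≤1 {_ ∷ _ ∷ _} _ _ _ = s≤s (s≤s z≤n)

        selected≤1 : length selected ℕ.≤ 1
        selected≤1 = begin
          length selected
            ≡⟨ ofColour-partition group selected ⟨
          length (ofColour group 0F selected) ℕ.+ length (ofColour group 1F selected)
            ≡⟨ cong₂ ℕ._+_ (count 0F) (count 1F) ⟩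
          length (ofColour group 0F (elements S)) ℕ.+ length (ofColour group 1F (elements S))
            ≡⟨ ofColour-partition group (elements S) ⟩
          length (elements S)
            ≤⟨ elements≤1 (elements-unique S) (All.tabulate (Equivalence.to ∈-elements)) ⟩
          1                                                                          ∎
          where
          open ℕ.≤-Reasoning
          count : ∀ i → length (ofColour group i selected) ≡ length (ofColour group i (elements S))
          count i = ≡.trans (selected-colour i) (≡.trans (≡.sym (feasible i)) (∣∩𝒳∣≡length (elements-unique S) ∈-elements i))

  double : ∀ x → fromℕ 2 * x ≈ x + x
  double x = begin-equality
    (1# + (1# + 0#)) * x          ≈⟨ distribʳ x 1# (1# + 0#) ⟩
    1# * x + (1# + 0#) * x        ≈⟨ +-congˡ (*-congʳ (+-identityʳ 1#)) ⟩
    1# * x + 1# * x               ≈⟨ +-cong (*-identityˡ x) (*-identityˡ x) ⟩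
    x + x                         ∎
    where open ≤-Reasoning

  quadruple : ∀ x → (x + x) + (x + x) ≈ fromℕ 4 * x
  quadruple x = begin-equality
    (x + x) + (x + x)        ≈⟨ double (x + x) ⟨
    fromℕ 2 * (x + x)        ≈⟨ *-congˡ (double x) ⟨
    fromℕ 2 * (fromℕ 2 * x)  ≈⟨ *-assoc (fromℕ 2) (fromℕ 2) x ⟨
    fromℕ 2 * fromℕ 2 * x    ≈⟨ *-congʳ (fromℕ-homo-* 2 2) ⟨
    fromℕ 4 * x              ∎
    where open ≤-Reasoning

  1≤4 : 1# ≤ fromℕ 4
  1≤4 = ≤⇒≤+ (fromℕ-nonNeg 3) ≤-refl

  -- The radii

  module Parameters (ε lo hi : Carrier) where

    private
      doubling? = λ j → ¬? (ε ⁻¹ ≤? fromℕ j)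
      octave? = λ j → fromℕ (2 ℕ.^ j) ≤? hi / lo
      -- The Archimedean witnesses may be far too large. They only bound the searches, which find
      -- the sharp values needed for the space bound.
      N₁ = proj₁ (archimedean (ε ⁻¹))
      N₂ = proj₁ (archimedean (hi / lo))

    -- (1 + ε)^steps ≥ 2 and 2^octaves > hi / lo, so steps * octaves levels reach hi.
    steps₀ octaves₀ steps octaves top : ℕ
    steps₀   = greatest doubling? N₁
    octaves₀ = greatest octave? N₂
    steps    = suc steps₀
    octaves  = suc octaves₀
    top      = ℕ.pred (steps ℕ.* octaves)

    radius : ℕ → Carrier
    radius j = lo / fromℕ 4 * (1# + ε) ^ j

    steps-≥ : ε ⁻¹ ≤ fromℕ steps
    -- With the negated comparison as `Q`, maximality yields a double negation, which decidability
    -- removes.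
    steps-≥ = decidable-stable (ε ⁻¹ ≤? fromℕ steps) (greatest-maximal doubling?
      {Q = λ j → ¬ (ε ⁻¹ ≤ fromℕ j)} N₁ (λ _ ¬≤ → ¬≤)
      (λ ¬≤ → ¬≤ (≤-trans (proj₂ (archimedean (ε ⁻¹))) (fromℕ-mono-≤ (ℕ.n≤1+n N₁)))))

    octaves-> : ¬ (fromℕ (2 ℕ.^ octaves) ≤ hi / lo)
    octaves-> = greatest-maximal octave? N₂ (λ _ 2^j≤ → 2^j≤) (λ 2^N≤ →
      ℕ.<⇒≱ (ℕ.<-trans (ℕ.n<1+n N₂) (n<2^n (suc N₂)))
        (fromℕ-cancel-≤ {2 ℕ.^ suc N₂} {N₂} (≤-trans 2^N≤ (proj₂ (archimedean (hi / lo))))))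

    module _ (0<ε : 0# < ε) (0<lo : 0# < lo) where

      private
        0≤ε = proj₁ 0<ε
        1≤1+ε : 1# ≤ 1# + ε
        1≤1+ε = ≤⇒≤+ 0≤ε ≤-refl

      quadruple-radius : ∀ j → (radius j + radius j) + (radius j + radius j) ≈ lo * (1# + ε) ^ j
      quadruple-radius j = begin-equality
        (radius j + radius j) + (radius j + radius j)  ≈⟨ quadruple (radius j) ⟩
        fromℕ 4 * (lo / fromℕ 4 * (1# + ε) ^ j)        ≈⟨ *-assoc (fromℕ 4) (lo / fromℕ 4) _ ⟨
        fromℕ 4 * (lo / fromℕ 4) * (1# + ε) ^ j        ≈⟨ *-congʳ (z*x/z≈x (1≤⇒0< 1≤4) lo) ⟩
        lo * (1# + ε) ^ j                              ∎
        where open ≤-Reasoning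

      radius-positive : ∀ j → ¬ (radius j ≤ 0#)
      radius-positive j r≤0 = <⇒≱ 0<lo (begin
        lo                                             ≈⟨ *-identityʳ lo ⟨
        lo * 1#                                        ≤⟨ *-monoˡ-≤ (proj₁ 0<lo) (1≤x^n 1≤1+ε j) ⟩
        lo * (1# + ε) ^ j                              ≈⟨ quadruple-radius j ⟨
        (radius j + radius j) + (radius j + radius j)  ≤⟨ +-mono-≤ (+-mono-≤ r≤0 r≤0) (+-mono-≤ r≤0 r≤0) ⟩
        (0# + 0#) + (0# + 0#)                          ≈⟨ +-cong (+-identityˡ 0#) (+-identityˡ 0#) ⟩
        0# + 0#                                        ≈⟨ +-identityˡ 0# ⟩
        0#                                             ∎)
        where open ≤-Reasoning

      radius-base : (radius 0 + radius 0) + (radius 0 + radius 0) ≤ lo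
      radius-base = ≤-reflexive (trans (quadruple-radius 0) (*-identityʳ lo))

      -- By Bernoulli's inequality every `steps` factors `1 + ε` at least double the radius, because
      -- `steps` is at least `1/ε`. After `octaves` doublings four times the radius exceeds `hi`.
      radius-top : ∀ {ℓ} → ℓ ≤ hi →
        ¬ ((radius (suc top) + radius (suc top)) + (radius (suc top) + radius (suc top)) ≤ ℓ)
      radius-top {ℓ} ℓ≤hi 4r≤ℓ = octaves-> (x*y≤z⇒y≤z/x 0<lo (begin
        lo * fromℕ (2 ℕ.^ octaves)             ≤⟨ *-monoˡ-≤ (proj₁ 0<lo) (fromℕ-^ {2} 2≤[1+ε]^steps octaves) ⟩
        lo * ((1# + ε) ^ steps) ^ octaves      ≈⟨ *-congˡ (^-assocʳ (1# + ε) steps octaves) ⟩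
        -- Both factors are successors, so `steps ℕ.* octaves` computes to `suc top`.
        lo * (1# + ε) ^ (steps ℕ.* octaves)    ≈⟨ quadruple-radius (suc top) ⟨
        (radius (suc top) + radius (suc top)) + (radius (suc top) + radius (suc top))  ≤⟨ 4r≤ℓ ⟩
        ℓ                                      ≤⟨ ℓ≤hi ⟩
        hi                                     ∎))
        where
        open ≤-Reasoning
        2≤[1+ε]^steps : fromℕ 2 ≤ (1# + ε) ^ steps
        2≤[1+ε]^steps = begin
          1# + (1# + 0#)          ≈⟨ +-congˡ (+-identityʳ 1#) ⟩
          1# + 1#                 ≈⟨ +-congˡ (⁻¹-inverse 0<ε) ⟨
          1# + ε * ε ⁻¹           ≤⟨ +-monoʳ-≤ 1# (*-monoˡ-≤ 0≤ε steps-≥) ⟩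
          1# + ε * fromℕ steps    ≈⟨ +-congˡ (*-comm ε (fromℕ steps)) ⟩
          1# + fromℕ steps * ε    ≤⟨ bernoulli 0≤ε steps ⟩
          (1# + ε) ^ steps        ∎

      -- Consecutive radii differ by the factor `1 + ε`, which is what the discrete guessing adds to
      -- the factor 4.
      radius-step : ∀ {ℓ} j →
        ¬ ((radius (suc j) + radius (suc j)) + (radius (suc j) + radius (suc j)) ≤ ℓ) →
        ℓ / (fromℕ 4 * (1# + ε)) ≤ radius j
      radius-step {ℓ} j ¬4r≤ℓ = x≤y*z⇒x/z≤y (1≤⇒0< 1≤4[1+ε]) (begin
        ℓ                                           ≤⟨ ≰⇒≥ ¬4r≤ℓ ⟩
        (radius (suc j) + radius (suc j)) + (radius (suc j) + radius (suc j))  ≈⟨ quadruple (radius (suc j)) ⟩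
        fromℕ 4 * (q * ((1# + ε) * (1# + ε) ^ j))   ≈⟨ *-congˡ (*-congˡ (*-comm (1# + ε) _)) ⟩
        fromℕ 4 * (q * ((1# + ε) ^ j * (1# + ε)))   ≈⟨ *-congˡ (*-assoc q _ _) ⟨
        fromℕ 4 * (radius j * (1# + ε))             ≈⟨ *-assoc (fromℕ 4) (radius j) (1# + ε) ⟨
        fromℕ 4 * radius j * (1# + ε)               ≈⟨ *-congʳ (*-comm (fromℕ 4) (radius j)) ⟩
        radius j * fromℕ 4 * (1# + ε)               ≈⟨ *-assoc (radius j) (fromℕ 4) (1# + ε) ⟩
        radius j * (fromℕ 4 * (1# + ε))             ∎)
        where
        open ≤-Reasoning
        q = lo / fromℕ 4
        1≤4[1+ε] : 1# ≤ fromℕ 4 * (1# + ε)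
        1≤4[1+ε] = begin
          1#                    ≈⟨ *-identityˡ 1# ⟨
          1# * 1#               ≤⟨ *-mono-≤ 0≤1 (fromℕ-nonNeg 4) 1≤4 1≤1+ε ⟩
          fromℕ 4 * (1# + ε)    ∎

      -- The search keeps `steps₀` at most `1/ε`, and the additional step costs 1, again at most
      -- `1/ε`.
      steps-≤ : ε ≤ 1# → fromℕ steps ≤ ε ⁻¹ * fromℕ 2
      steps-≤ ε≤1 = begin
        1# + fromℕ steps₀   ≤⟨ +-mono-≤ 1≤ε⁻¹ (≰⇒≥ (greatest-satisfies doubling? ε⁻¹≰0 N₁)) ⟩
        ε ⁻¹ + ε ⁻¹         ≈⟨ double (ε ⁻¹) ⟨
        fromℕ 2 * ε ⁻¹      ≈⟨ *-comm (fromℕ 2) (ε ⁻¹) ⟩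
        ε ⁻¹ * fromℕ 2      ∎
        where
        open ≤-Reasoning
        1≤ε⁻¹ : 1# ≤ ε ⁻¹
        1≤ε⁻¹ = begin
          1#         ≈⟨ ⁻¹-inverse 0<ε ⟨
          ε * ε ⁻¹   ≤⟨ *-monoʳ-≤ (⁻¹-nonNeg 0<ε) ε≤1 ⟩
          1# * ε ⁻¹  ≈⟨ *-identityˡ (ε ⁻¹) ⟩
          ε ⁻¹       ∎
        ε⁻¹≰0 : ¬ (ε ⁻¹ ≤ 0#)
        ε⁻¹≰0 ε⁻¹≤0 = 1≰0 (≤-trans 1≤ε⁻¹ ε⁻¹≤0)

      octaves-≤ : ∀ a e {n} → 2 ℕ.≤ n → lo ≤ hi → hi / lo ≤ fromℕ (a ℕ.* n ℕ.^ e) →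
                  octaves ℕ.≤ (1 ℕ.+ a ℕ.+ 2 ℕ.* e) ℕ.* ⌊log₂ n ⌋
      octaves-≤ a e {n} 2≤n lo≤hi hi/lo≤ = poly-log a e n octaves₀ 2≤n
        (fromℕ-cancel-≤ {2 ℕ.^ octaves₀} {a ℕ.* n ℕ.^ e}
          (≤-trans (greatest-satisfies octave? 1≤hi/lo N₂) hi/lo≤))
        where
        -- This is the test at 0, as `2 ^ 0` is 1, so that the default of the search is sound.
        1≤hi/lo : fromℕ 1 ≤ hi / lo
        1≤hi/lo = x*y≤z⇒y≤z/x 0<lo (≤-trans
          (≤-reflexive (trans (*-congˡ (+-identityʳ 1#)) (*-identityʳ lo))) lo≤hi)

      -- The constant collects a 2 from the capacity `2 * K` of a level, `b` from the number of
      -- octaves per unit of `L`, and another 2 from bounding `steps` by `2/ε`.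
      space-bound : ε ≤ 1# → ∀ b K L s → octaves ℕ.≤ b ℕ.* L → s ℕ.≤ suc top ℕ.* (2 ℕ.* K) →
        fromℕ s ≤ fromℕ (2 ℕ.* b ℕ.* 2) * (fromℕ K * ε ⁻¹ * fromℕ L)
      space-bound ε≤1 b K L s octaves≤ s≤ = begin
        fromℕ s                                           ≤⟨ fromℕ-mono-≤ s≤′ ⟩
        fromℕ (2 ℕ.* b ℕ.* (K ℕ.* steps ℕ.* L))           ≈⟨ fromℕ-homo-* (2 ℕ.* b) (K ℕ.* steps ℕ.* L) ⟩
        2b * fromℕ (K ℕ.* steps ℕ.* L)
          ≈⟨ *-congˡ (trans (fromℕ-homo-* (K ℕ.* steps) L) (*-congʳ (fromℕ-homo-* K steps))) ⟩
        2b * (fromℕ K * fromℕ steps * fromℕ L)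
          ≤⟨ *-monoˡ-≤ (fromℕ-nonNeg (2 ℕ.* b)) (*-monoʳ-≤ (fromℕ-nonNeg L) (*-monoˡ-≤ (fromℕ-nonNeg K) (steps-≤ ε≤1))) ⟩
        2b * (fromℕ K * (ε ⁻¹ * fromℕ 2) * fromℕ L)
          ≈⟨ *-congˡ (*-congʳ (trans (*-congˡ (*-comm (ε ⁻¹) (fromℕ 2))) (x∙yz≈y∙xz (fromℕ K) (fromℕ 2) (ε ⁻¹)))) ⟩
        2b * (fromℕ 2 * (fromℕ K * ε ⁻¹) * fromℕ L)
          ≈⟨ *-congˡ (*-assoc (fromℕ 2) (fromℕ K * ε ⁻¹) (fromℕ L)) ⟩
        2b * (fromℕ 2 * (fromℕ K * ε ⁻¹ * fromℕ L))        ≈⟨ *-assoc 2b (fromℕ 2) _ ⟨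
        2b * fromℕ 2 * (fromℕ K * ε ⁻¹ * fromℕ L)          ≈⟨ *-congʳ (fromℕ-homo-* (2 ℕ.* b) 2) ⟨
        fromℕ (2 ℕ.* b ℕ.* 2) * (fromℕ K * ε ⁻¹ * fromℕ L) ∎
        where
        open ≤-Reasoning
        open import Algebra.Properties.CommutativeSemigroup *-commutativeSemigroup using (x∙yz≈y∙xz)
        2b = fromℕ (2 ℕ.* b)
        s≤′ : s ℕ.≤ 2 ℕ.* b ℕ.* (K ℕ.* steps ℕ.* L)
        s≤′ = ℕ.≤-trans s≤ (ℕ.≤-trans
          (ℕ.*-monoˡ-≤ (2 ℕ.* K) (ℕ.*-monoʳ-≤ steps octaves≤))
          (ℕ.≤-reflexive (solve 4 (λ t b L K → (t :* (b :* L)) :* (con 2 :* K) := con 2 :* b :* (K :* t :* L))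
            ≡.refl steps b L K)))
          where open +-*-Solver

theorem8 :
    ∀ {c ℓ₁ ℓ₂} (F : ArchimedeanOrderedField c ℓ₁ ℓ₂) →
    let open ArchimedeanOrderedField F
        open Diversification F
    in
    (a e : ℕ) →
    Σ[ algorithm ∈ ((ε : Carrier) (k : Fin 2 → ℕ) (lo hi : Carrier) → StreamingAlgorithm 2) ]
    ∃[ C ]
    ((ε : Carrier) → 0# < ε → ε < 1# →
     (I : Instance 2) →
     let open Instance I in
     (lo hi : Carrier) → 0# < lo →
     (∀ {x y} → x ≢ y → lo ≤ d x y × d x y ≤ hi) →
     hi / lo ≤ fromℕ (a ℕ.* n ℕ.^ e) →
     (stream : List (Fin n)) → stream ↭ allFin n →
     let open Run (algorithm ε k lo hi) I in
     Feasible (result stream) ×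
     ((ℓ* : Carrier ⁺) → IsOptimalDiversity ℓ* →
       ℓ* /⁺ (fromℕ 4 * (1# + ε)) ≤⁺ div (result stream)) ×
     (2 ℕ.≤ n →
       fromℕ (space stream) ≤ fromℕ C * (fromℕ totalSize * ε ⁻¹ * fromℕ ⌊log₂ n ⌋)))
theorem8 F a e = algorithm , 2 ℕ.* b ℕ.* 2 , correct
  where
  open ArchimedeanOrderedField F
  open OrderedFieldProperties F
  open Diversification F
  open SupremumOrder _≤_ using (_≤⊤⁺; [_])
  open TotalOrder ≤⁺-totalOrder using () renaming (reflexive to ≤⁺-reflexive; trans to ≤⁺-trans; module Eq to ≈⁺)

  b : ℕ
  b = 1 ℕ.+ a ℕ.+ 2 ℕ.* e

  algorithm : (ε : Carrier) (k : Fin 2 → ℕ) (lo hi : Carrier) → StreamingAlgorithm 2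
  algorithm ε k lo hi = streaming F k radius top
    where open Parameters F ε lo hi

  correct : (ε : Carrier) → 0# < ε → ε < 1# →
     (I : Instance 2) →
     let open Instance I in
     (lo hi : Carrier) → 0# < lo →
     (∀ {x y} → x ≢ y → lo ≤ d x y × d x y ≤ hi) →
     hi / lo ≤ fromℕ (a ℕ.* n ℕ.^ e) →
     (stream : List (Fin n)) → stream ↭ allFin n →
     let open Run (algorithm ε k lo hi) I in
     Feasible (result stream) ×
     ((ℓ* : Carrier ⁺) → IsOptimalDiversity ℓ* →
       ℓ* /⁺ (fromℕ 4 * (1# + ε)) ≤⁺ div (result stream)) ×
     (2 ℕ.≤ n →
       fromℕ (space stream) ≤ fromℕ (2 ℕ.* b ℕ.* 2) * (fromℕ totalSize * ε ⁻¹ * fromℕ ⌊log₂ n ⌋))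
  correct ε 0<ε ε<1 I lo hi 0<lo d-bounds hi/lo≤ stream complete =
    result-feasible positive base stream complete , approximation , economy
    where
    open Instance I
    open InstanceProperties F I
    open Parameters F ε lo hi
    open Analysis F I radius top
    open Run (streaming F k radius top) I

    positive : ∀ j → ¬ (radius j ≤ 0#)
    positive = radius-positive 0<ε 0<lo

    base : ∀ {x y} → x ≢ y → (radius 0 + radius 0) + (radius 0 + radius 0) ≤ d x y
    base x≢y = ≤-trans (radius-base 0<ε 0<lo) (proj₁ (d-bounds x≢y))

    approximation : ∀ ℓ* → IsOptimalDiversity ℓ* → ℓ* /⁺ (fromℕ 4 * (1# + ε)) ≤⁺ div (result stream)
    -- An infinite optimum leaves no two distinct points in `S`, since their distance would bound
    -- its diversity.
    approximation ⊤⁺ ((S , feasible , div≈⊤) , _) = result-trivial positive base stream complete feasible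
      (λ u∈S v∈S u≢v → ⊤≰ (≤⁺-trans (≤⁺-reflexive (≈⁺.sym div≈⊤)) (div-≤ S u∈S v∈S u≢v)))
      where
      ⊤≰ : ∀ {x} → ¬ (⊤⁺ ≤⁺ [ x ])
      ⊤≰ ()
    approximation [ ℓ ] ((S , feasible , div≈ℓ) , _) =
      -- The pair realising `ℓ` shows that `ℓ` is at most `hi`, so the radii range beyond it.
      let x , y , x≢y , dxy≈ℓ = div-attained S div≈ℓ
          j , ¬4r≤ℓ , r≤div = result-diverse positive base stream complete feasible
            (λ u∈S v∈S u≢v → SupremumOrder.[≤]-injective _≤_
              (≤⁺-trans (≤⁺-reflexive (≈⁺.sym div≈ℓ)) (div-≤ S u∈S v∈S u≢v)))
            (radius-top 0<ε 0<lo (≤-trans (≤-reflexive (sym dxy≈ℓ)) (proj₂ (d-bounds x≢y))))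
      in ≤⁺-trans [ radius-step 0<ε 0<lo j ¬4r≤ℓ ] r≤div

    economy : 2 ℕ.≤ n →
      fromℕ (space stream) ≤ fromℕ (2 ℕ.* b ℕ.* 2) * (fromℕ totalSize * ε ⁻¹ * fromℕ ⌊log₂ n ⌋)
    -- Two distinct points exist, and their distance lies between `lo` and `hi`; this gives
    -- `lo ≤ hi`.
    economy 2≤n = let _ , _ , x≢y = distinct-points 2≤n in
      space-bound 0<ε 0<lo (proj₁ ε<1) b totalSize ⌊log₂ n ⌋ (space stream)
        (octaves-≤ 0<ε 0<lo a e 2≤n (≤-trans (proj₁ (d-bounds x≢y)) (proj₂ (d-bounds x≢y))) hi/lo≤)
        -- `totalSize` unfolds to a sum that ends in `+ 0`.
        (subst (λ K → space stream ℕ.≤ suc top ℕ.* (2 ℕ.* K))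
          (cong (k 0F ℕ.+_) (≡.sym (ℕ.+-identityʳ (k 1F)))) (space-≤ stream))
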